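{- Let $\mathcal{H}$ be a hypergraph with $|V(\mathcal{H})|=n$ and let $\sigma:[n]\to V(\mathcal{H})$ be an arbitrary bijection. Let $d,q,r,t$ be positive integers with $r\geq 2$ and $q\geq (d-1)(t-1)+1$. Then any coloring of the vertices of $\operatorname{KG}^r(\mathcal{H})$ with no monochromatic $K^r_{t,\dots,t}$ subhypergraph uses at least $$\min\left\{\left\lceil\frac{n-\operatorname{alt}_r(\mathcal{H},\sigma,q)}{r-1}\right\rceil,\, d\right\}$$ colors.
   Context: A hypergraph $\mathcal{H}$ has a finite nonempty vertex set and a family $E(\mathcal{H})$ of distinct nonempty subsets (edges). For $S\subseteq V(\mathcal{H})$, $\mathcal{H}[S]$ is the induced subhypergraph on $S$ (edges of $\mathcal{H}$ contained in $S$). For $r\ge2$, $\operatorname{KG}^r(\mathcal{H})$ has vertex set $E(\mathcal{H})$ and edges the $r$-sets of pairwise disjoint edges of $\mathcal{H}$. $K^r_{t,\dots,t}$ is the complete $r$-uniform $r$-partite hypergraph with parts of size $t$; a $K^r_{t,\dots,t}$ subhypergraph of an $r$-uniform hypergraph $\mathcal{G}$ is given by pairwise disjoint $t$-sets $W_1,\dots,W_r\subseteq V(\mathcal{G})$ such that every set $\{w_1,\dots,w_r\}$ with $w_i\in W_i$ is an edge of $\mathcal{G}$; it is monochromatic if all vertices in $W_1\cup\dots\cup W_r$ receive the same color. Alternation number: let $\mathbb{Z}_r=\{\omega^1,\dots,\omega^r\}$ be cyclic of order $r$. For $X=(x_1,\dots,x_n)\in(\mathbb{Z}_r\cup\{0\})^n$,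 $\operatorname{alt}(X)$ is the maximum length of a subsequence $x_{i_1},\dots,x_{i_k}$ ($i_1<\dots<i_k$) of nonzero entries with consecutive terms distinct ($\operatorname{alt}(0,\dots,0)=0$), and $X^i=\{j: x_j=\omega^i\}$. Then $\operatorname{alt}_r(\mathcal{H},\sigma,q)=\max\{\operatorname{alt}(X): X\in(\mathbb{Z}_r\cup\{0\})^n,\ |E(\mathcal{H}[\sigma(X^i)])|\leq q-1\ \forall i\in[r]\}$. -}

module Defs where

open import Data.Nat using (ℕ; zero; suc; _+_; _*_; _∸_; _≤_; _⊔_; _⊓_)
open import Data.Nat.DivMod using (_/_)
open import Data.Fin using (Fin)
open import Data.Fin.Subset using (Subset; _∈_; _⊆_; Nonempty)
open import Data.Fin.Subset.Properties using (_⊆?_)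
open import Data.Fin.Permutation using (Permutation′; _⟨$⟩ʳ_; _⟨$⟩ˡ_)
open import Data.Fin.Properties as FinP using ()
open import Data.Maybe using (Maybe; just; nothing)
open import Data.Maybe.Properties using (≡-dec)
open import Data.List using (List; []; _∷_; length; filter; allFin; tabulate)
open import Data.Vec as Vec using ()
open import Data.Product using (Σ; _×_; _,_; ∃)
open import Data.Empty using (⊥)
open import Relation.Nullary using (¬_; yes; no)
open import Relation.Nullary.Decidable using (⌊_⌋)
open import Relation.Binary.PropositionalEquality using (_≡_)
open import Function.Definitions using (Injective)

record Hypergraph (n : ℕ) : Set where
  field
    nonemptyV : 1 ≤ n
    m         : ℕ
    edge      : Fin m → Subset n
    distinct  : Injective _≡_ _≡_ edge
    nonemptyE : ∀ e → Nonempty (edge e)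
open Hypergraph public

Disjoint : ∀ {n} → Subset n → Subset n → Set
Disjoint p q = ∀ x → x ∈ p → x ∈ q → ⊥

inducedEdgeCount : ∀ {n} → Hypergraph n → Subset n → ℕ
inducedEdgeCount H S = length (filter (λ e → edge H e ⊆? S) (allFin (m H)))

-- Elements of (Z_r ∪ {0}): nothing = 0, just i = ω^(i+1).
-- altFrom last xs = maximum length of a subsequence of nonzero entries of xs
-- with consecutive terms distinct, whose first term differs from 'last'
-- (last = nothing means no constraint).
altFrom : ∀ {r} → Maybe (Fin r) → List (Maybe (Fin r)) → ℕ
altFrom last [] = 0
altFrom last (nothing ∷ xs) = altFrom last xs
altFrom {r} last (just a ∷ xs) with ≡-dec FinP._≟_ last (just a)
... | yes _ = altFrom last xs
... | no  _ = altFrom last xs ⊔ suc (altFrom (just a) xs)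

alt : ∀ {n r} → (Fin n → Maybe (Fin r)) → ℕ
alt X = altFrom nothing (tabulate X)

imageClass : ∀ {n r} → Permutation′ n → (Fin n → Maybe (Fin r)) → Fin r → Subset n
imageClass σ X i = Vec.tabulate (λ v → ⌊ ≡-dec FinP._≟_ (X (σ ⟨$⟩ˡ v)) (just i) ⌋)

Admissible : ∀ {n} (r : ℕ) → Hypergraph n → Permutation′ n → ℕ → (Fin n → Maybe (Fin r)) → Set
Admissible r H σ q X = ∀ (i : Fin r) → inducedEdgeCount H (imageClass σ X i) ≤ q ∸ 1

IsAltR : ∀ {n} (r : ℕ) → Hypergraph n → Permutation′ n → ℕ → ℕ → Set
IsAltR r H σ q a =
  (∃ λ X → Admissible r H σ q X × alt X ≡ a) ×
  (∀ X → Admissible r H σ q X → alt X ≤ a)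

-- ⌈ a / b ⌉ for b ≥ 1 (value for b = 0 is irrelevant, set to 0).
⌈_/_⌉ : ℕ → ℕ → ℕ
⌈ a / zero ⌉ = 0
⌈ a / suc b ⌉ = (a + b) / suc b

-- A K^r_{t,...,t} in KG^r(H): W i j (i : Fin r, j : Fin t) are pairwise distinct
-- vertices of KG^r(H) (i.e. edges of H), so W_1,...,W_r are pairwise disjoint t-sets,
-- and every transversal {W 1 (f 1), ..., W r (f r)} is an edge of KG^r(H), i.e.
-- consists of r pairwise disjoint edges of H.
IsKrt : ∀ {n} (H : Hypergraph n) (r t : ℕ) → (Fin r → Fin t → Fin (m H)) → Set
IsKrt H r t W =
  (∀ i j i′ j′ → W i j ≡ W i′ j′ → (i ≡ i′) × (j ≡ j′)) ×
  (∀ (f : Fin r → Fin t) → ∀ i i′ → ¬ (i ≡ i′) →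
     Disjoint (edge H (W i (f i))) (edge H (W i′ (f i′))))

-- A coloring of V(KG^r(H)) = E(H) with k colors.
Coloring : ∀ {n} → Hypergraph n → ℕ → Set
Coloring H k = Fin (m H) → Fin k

MonochromaticKrt : ∀ {n} (H : Hypergraph n) (r t : ℕ) {k : ℕ} → Coloring H k → Set
MonochromaticKrt H r t c =
  Σ (Fin r → Fin t → Fin (m H)) λ W → IsKrt H r t W ×
    (∀ i j i′ j′ → c (W i j) ≡ c (W i′ j′))

{-# OPTIONS --safe #-}
module Submission where

-- Call a set of positions rich in colour j if its image under σ contains at least t edges of
-- colour j. With k < d colours, a class with at least q edges is rich in some colour, and a sign
-- vector all of whose classes are rich in the same colour yields a monochromatic K^r_{t,…,t}.
-- So it suffices to show, for monotone families F_1, …, F_k of subsets of [n]: either some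
-- X ∈ (Z_r ∪ {0})^n has all its classes in one F_j, or some X has no class in any F_j and
-- alt X ≥ n − (r−1)k.
--
-- For r = p prime, failure of both gives a Z_p-labelling of the nonzero sign vectors with
-- fewer than n levels: the level is alt X while this is small, and afterwards increases with
-- the number of pairs (i, j) with X^i ∈ F_j; the sign is the first nonzero entry, respectively
-- the centre of mass mod p of {i : X^i ∈ F_j} for the first j where this set is nonempty (it is
-- never all of Z_p). Such a labelling does not exist (a Z_p-Tucker lemma): the n-fold join of
-- Z_p admits a chain map from the first n terms of the periodic resolution of Z_p, and each
-- level, being a free Z_p-set of mutually incomparable pieces, can be removed from its support
-- at the cost of one degree, until the empty complex would carry a chain of augmentation
-- 1 mod p.
--
-- For r = p s, apply the case p to G_j = {A : A contains disjoint S_1, …, S_s ∈ F_j}. If no class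
-- of X is in any G_j, the case s inside each class X^i gives Y_i with
-- alt Y_i ≥ |X^i| − (s−1)k, and the Y_i together form the required Z_r-vector.

open import Defs
open import Algebra.Properties.CommutativeMonoid.Sum using ()
open import Data.Bool using (Bool; true; false; not)
open import Data.Bool.Properties using (not-involutive)
open import Data.Empty using (⊥-elim)
open import Data.Fin using (Fin; zero; suc; toℕ; combine; inject≤)
open import Data.Fin.Permutation using (Permutation′; permutation; _⟨$⟩ˡ_)
import Data.Fin.Properties as FinP
open import Data.Fin.Subset using (Subset; _∈_; _⊆_; _∩_; ∣_∣)
open import Data.Fin.Subset.Properties using (_⊆?_; ⊆-trans; ⊆-antisym; drop-∷-⊆; x∈p∩q⁺; x∈p∩q⁻)
open import Data.Integer as ℤ using (ℤ; 0ℤ; 1ℤ) renaming (+_ to nat)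
import Data.Integer.Properties as ℤP
import Data.Integer.Tactic.RingSolver as ℤSolver
open import Data.List as List using (List; []; _∷_; length; filter; allFin)
open import Data.List.Membership.Propositional.Properties using (∈-lookup; ∈-filter⁻)
open import Data.List.Properties using (filter-accept; filter-reject)
open import Data.List.Relation.Binary.Sublist.Propositional using () renaming (⊆-refl to ⊆-sublist-refl)
open import Data.List.Relation.Binary.Sublist.Propositional.Properties using (length-mono-≤; filter⁺)
import Data.List.Relation.Unary.All as All
import Data.List.Relation.Unary.AllPairs as AllPairs
open import Data.List.Relation.Unary.Unique.Propositional using (Unique)
import Data.List.Relation.Unary.Unique.Propositional.Properties as Uniqueₚ
open import Data.Maybe as Maybe using (Maybe; just; nothing)
import Data.Maybe.Properties as MaybeP
open import Data.Nat
open import Data.Nat.Coprimality using (prime⇒coprime; coprime⇒gcd≡1)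
open import Data.Nat.Divisibility using (_∣_; divides; ∣1⇒≡1; hasNonTrivialDivisor)
open import Data.Nat.DivMod
open import Data.Nat.GCD using (gcd; gcd-comm; gcd-GCD; module Bézout)
open import Data.Nat.Induction using (<-rec)
open import Data.Nat.Primality using (Prime; prime?; prime⇒nonTrivial; ¬prime⇒composite)
open import Data.Nat.Properties
import Data.Nat.Tactic.RingSolver as ℕSolver
open import Data.Product using (∃; _×_; _,_; proj₁; proj₂)
open import Data.Sum using (_⊎_; inj₁; inj₂)
open import Data.Unit using (⊤)
open import Data.Vec as Vec using (Vec; []; _∷_; replicate; lookup; tabulate; head; tail; here; there)
open import Data.Vec.Functional using (updateAt)
open import Data.Vec.Functional.Properties using (updateAt-updates; updateAt-minimal)
import Data.Vec.Properties as VecP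
open import Function using (_∘_; const)
open import Relation.Binary.PropositionalEquality
open import Relation.Nullary using (¬_; Dec; yes; no; contradiction)
open import Relation.Nullary.Decidable using (⌊_⌋; map′; ¬?; _×-dec_; _⊎-dec_)
open import Relation.Unary using (Decidable)

module ∑ℤ = Algebra.Properties.CommutativeMonoid.Sum ℤP.+-0-commutativeMonoid
module ∑ℕ = Algebra.Properties.CommutativeMonoid.Sum +-0-commutativeMonoid
open ∑ℕ using (sum)

-- Sign vectors as simplices

SignVector : ℕ → ℕ → Set
SignVector r n = Vec (Maybe (Fin r)) n

𝟎 : ∀ {r n} → SignVector r n
𝟎 = replicate _ nothing

infix 4 _⊑_
-- The face relation in the join of `n` copies of `Fin r`.
data _⊑_ {r} : ∀ {n} → SignVector r n → SignVector r n → Set where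
  []   : [] ⊑ []
  skip : ∀ {n} {X Y : SignVector r n} {y} → X ⊑ Y → nothing ∷ X ⊑ y ∷ Y
  keep : ∀ {n} {X Y : SignVector r n} {x} → X ⊑ Y → x ∷ X ⊑ x ∷ Y

⊑-refl : ∀ {r n} {X : SignVector r n} → X ⊑ X
⊑-refl {X = []}    = []
⊑-refl {X = _ ∷ X} = keep ⊑-refl

-- The cyclic group and its action on sign vectors

module Cyclic (P : ℕ) where

  p : ℕ
  p = suc P

  el : ℕ → Fin p
  el j = j mod p

  toℕ-el : ∀ j → toℕ (el j) ≡ j % p
  toℕ-el j = FinP.toℕ-fromℕ< (m%n<n j p)

  el-cong : ∀ a b → a % p ≡ b % p → el a ≡ el b
  el-cong a b eq = FinP.toℕ-injective (trans (toℕ-el a) (trans eq (sym (toℕ-el b))))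

  el-toℕ : ∀ i → el (toℕ i) ≡ i
  el-toℕ i = FinP.toℕ-injective (trans (toℕ-el (toℕ i)) (m<n⇒m%n≡m (FinP.toℕ<n i)))

  el-+-* : ∀ a m → el (a + m * p) ≡ el a
  el-+-* a m = el-cong (a + m * p) a ([m+kn]%n≡m%n a m p)

  el-+-el : ∀ c j → el (c + toℕ (el j)) ≡ el (c + j)
  el-+-el c j = sym (begin
    el (c + j)                       ≡⟨ cong (λ z → el (c + z)) (m≡m%n+[m/n]*n j p) ⟩
    el (c + (j % p + (j / p) * p))   ≡⟨ cong el (sym (+-assoc c _ _)) ⟩
    el (c + j % p + (j / p) * p)     ≡⟨ el-+-* (c + j % p) (j / p) ⟩
    el (c + j % p)                   ≡⟨ cong (λ z → el (c + z)) (sym (toℕ-el j)) ⟩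
    el (c + toℕ (el j))              ∎)
    where open ≡-Reasoning

  rotBy : ℕ → Fin p → Fin p
  rotBy c i = el (c + toℕ i)

  rot : Fin p → Fin p
  rot = rotBy 1

  rotBy-p : ∀ i → rotBy p i ≡ i
  rotBy-p i = begin
    el (p + toℕ i)      ≡⟨ cong el (+-comm p (toℕ i)) ⟩
    el (toℕ i + p)      ≡⟨ el-cong (toℕ i + p) (toℕ i) ([m+n]%n≡m%n (toℕ i) p) ⟩
    el (toℕ i)          ≡⟨ el-toℕ i ⟩
    i                   ∎
    where open ≡-Reasoning

  rotBy-rot : ∀ c i → rotBy c (rot i) ≡ rotBy (suc c) i
  rotBy-rot c i = trans (el-+-el c (suc (toℕ i))) (cong el (+-suc c (toℕ i)))

  rotBy-P-rot : ∀ i → rotBy P (rot i) ≡ i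
  rotBy-P-rot i = trans (rotBy-rot P i) (rotBy-p i)

  rot-injective : ∀ {i j} → rot i ≡ rot j → i ≡ j
  rot-injective {i} {j} eq =
    trans (sym (rotBy-P-rot i)) (trans (cong (rotBy P) eq) (rotBy-P-rot j))

  rotation : Permutation′ p
  rotation = permutation rot (rotBy P)
    (λ i → trans (el-+-el 1 (P + toℕ i)) (rotBy-p i)) rotBy-P-rot

  rotV : ∀ {n} → SignVector p n → SignVector p n
  rotV = Vec.map (Maybe.map rot)

  rotV^ : ∀ {n} → ℕ → SignVector p n → SignVector p n
  rotV^ zero    X = X
  rotV^ (suc c) X = rotV^ c (rotV X)

  rotV^-map : ∀ {n} c (X : SignVector p n) → rotV^ c X ≡ Vec.map (Maybe.map (rotBy c)) X
  rotV^-map zero X = sym (trans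
    (VecP.map-cong (λ x → trans (MaybeP.map-cong el-toℕ x) (MaybeP.map-id x)) X)
    (VecP.map-id X))
  rotV^-map (suc c) X = begin
    rotV^ c (rotV X)
      ≡⟨ rotV^-map c (rotV X) ⟩
    Vec.map (Maybe.map (rotBy c)) (rotV X)
      ≡⟨ VecP.map-∘ _ _ X ⟨
    Vec.map (Maybe.map (rotBy c) ∘ Maybe.map rot) X
      ≡⟨ VecP.map-cong (λ x → trans (sym (MaybeP.map-∘ x)) (MaybeP.map-cong (rotBy-rot c) x)) X ⟩
    Vec.map (Maybe.map (rotBy (suc c))) X ∎
    where open ≡-Reasoning

  rotV^-p : ∀ {n} (X : SignVector p n) → rotV^ p X ≡ X
  rotV^-p X = trans (rotV^-map p X) (trans
    (VecP.map-cong (λ x → trans (MaybeP.map-cong rotBy-p x) (MaybeP.map-id x)) X)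
    (VecP.map-id X))

  rotV-𝟎 : ∀ n → rotV (𝟎 {n = n}) ≡ 𝟎
  rotV-𝟎 n = VecP.map-replicate _ nothing n

  -- Chains of the join and their boundary

  -- A chain is its coefficient function, not graded by dimension, so identities are checked one
  -- coefficient at a time.
  Chain : ℕ → Set
  Chain n = SignVector p n → ℤ

  -- The augmented simplicial boundary of the join of n copies of Z_p, whose
  -- simplices are the sign vectors; 𝟎 is the empty simplex.
  ∂ : ∀ {n} → Chain n → Chain n
  ∂ x []            = 0ℤ
  ∂ x (nothing ∷ Y) = ∑ℤ.sum (λ g → x (just g ∷ Y)) ℤ.+ ∂ (x ∘ (nothing ∷_)) Y
  ∂ x (just a ∷ Y)  = ℤ.- ∂ (x ∘ (just a ∷_)) Y

  -- Only simplices with one vertex more than `Y` contribute to the boundary at `Y`. This locality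
  -- is what allows chains to be altered level by level.
  ∂-local : ∀ {n} {x y : Chain n} Y →
    (∀ Z → Y ⊑ Z → Z ≢ Y → x Z ≡ y Z) → ∂ x Y ≡ ∂ y Y
  ∂-local []            eq = refl
  ∂-local (nothing ∷ Y) eq = cong₂ ℤ._+_
    (∑ℤ.sum-cong-≗ (λ g → eq (just g ∷ Y) (skip ⊑-refl) λ ()))
    (∂-local Y (λ Z Y⊑Z Z≢Y → eq (nothing ∷ Z) (keep Y⊑Z) (Z≢Y ∘ VecP.∷-injectiveʳ)))
  ∂-local (just a ∷ Y)  eq = cong ℤ.-_
    (∂-local Y (λ Z Y⊑Z Z≢Y → eq (just a ∷ Z) (keep Y⊑Z) (Z≢Y ∘ VecP.∷-injectiveʳ)))

  ∂-cong : ∀ {n} {x y : Chain n} → x ≗ y → ∂ x ≗ ∂ y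
  ∂-cong eq Y = ∂-local Y (λ Z _ _ → eq Z)

  ∂-zero : ∀ {n} (Y : SignVector p n) → ∂ (λ _ → 0ℤ) Y ≡ 0ℤ
  ∂-zero []            = refl
  ∂-zero (nothing ∷ Y) = cong₂ ℤ._+_ (∑ℤ.sum-replicate-zero p) (∂-zero Y)
  ∂-zero (just a ∷ Y)  = cong ℤ.-_ (∂-zero Y)

  ∂-+ : ∀ {n} (x y : Chain n) Y → ∂ (λ Z → x Z ℤ.+ y Z) Y ≡ ∂ x Y ℤ.+ ∂ y Y
  ∂-+ x y []            = refl
  ∂-+ x y (nothing ∷ Y) = trans
    (cong₂ ℤ._+_ (∑ℤ.∑-distrib-+ (λ g → x (just g ∷ Y)) (λ g → y (just g ∷ Y)))
      (∂-+ (x ∘ (nothing ∷_)) _ Y))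
    (interchange (∑ℤ.sum (λ g → x (just g ∷ Y))) _ _ _)
    where
    interchange : ∀ a b c d → (a ℤ.+ b) ℤ.+ (c ℤ.+ d) ≡ (a ℤ.+ c) ℤ.+ (b ℤ.+ d)
    interchange = ℤSolver.solve-∀
  ∂-+ x y (just a ∷ Y)  = trans
    (cong ℤ.-_ (∂-+ (x ∘ (just a ∷_)) _ Y)) (ℤP.neg-distrib-+ (∂ (x ∘ (just a ∷_)) Y) _)

  ∂-sub : ∀ {n} (x y : Chain n) Y → ∂ (λ Z → x Z ℤ.- y Z) Y ≡ ∂ x Y ℤ.- ∂ y Y
  ∂-sub x y Y = begin
    ∂ d Y                       ≡⟨ a≡a+b-b (∂ d Y) (∂ y Y) ⟩
    ∂ d Y ℤ.+ ∂ y Y ℤ.- ∂ y Y   ≡⟨ cong (ℤ._- ∂ y Y) (∂-+ d y Y) ⟨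
    ∂ (λ Z → d Z ℤ.+ y Z) Y ℤ.- ∂ y Y
      ≡⟨ cong (ℤ._- ∂ y Y) (∂-cong (λ Z → a-b+b≡a (x Z) (y Z)) Y) ⟩
    ∂ x Y ℤ.- ∂ y Y             ∎
    where
    open ≡-Reasoning
    d : Chain _
    d Z = x Z ℤ.- y Z
    a≡a+b-b : ∀ a b → a ≡ a ℤ.+ b ℤ.- b
    a≡a+b-b = ℤSolver.solve-∀
    a-b+b≡a : ∀ a b → a ℤ.- b ℤ.+ b ≡ a
    a-b+b≡a = ℤSolver.solve-∀

  ∂-sum : ∀ {m n} (f : Fin m → Chain n) Y →
    ∂ (λ Z → ∑ℤ.sum (λ i → f i Z)) Y ≡ ∑ℤ.sum (λ i → ∂ (f i) Y)
  ∂-sum {zero}  f Y = ∂-zero Y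
  ∂-sum {suc m} f Y = trans (∂-+ (f zero) _ Y) (cong (ℤ._+_ (∂ (f zero) Y)) (∂-sum (f ∘ suc) Y))

  sum-neg : ∀ {m} (f : Fin m → ℤ) → ∑ℤ.sum (λ i → ℤ.- f i) ≡ ℤ.- ∑ℤ.sum f
  sum-neg {zero}  f = refl
  sum-neg {suc m} f = trans (cong (ℤ._+_ (ℤ.- f zero)) (sum-neg (f ∘ suc)))
    (sym (ℤP.neg-distrib-+ (f zero) _))

  ∂-neg : ∀ {n} (x : Chain n) Y → ∂ (λ Z → ℤ.- x Z) Y ≡ ℤ.- ∂ x Y
  ∂-neg x Y = begin
    ∂ (λ Z → ℤ.- x Z) Y          ≡⟨ ∂-cong (λ Z → sym (ℤP.+-identityˡ (ℤ.- x Z))) Y ⟩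
    ∂ (λ Z → 0ℤ ℤ.- x Z) Y       ≡⟨ ∂-sub (λ _ → 0ℤ) x Y ⟩
    ∂ (λ _ → 0ℤ) Y ℤ.- ∂ x Y     ≡⟨ cong (ℤ._- ∂ x Y) (∂-zero Y) ⟩
    0ℤ ℤ.- ∂ x Y                 ≡⟨ ℤP.+-identityˡ _ ⟩
    ℤ.- ∂ x Y                    ∎
    where open ≡-Reasoning

  -- A pair of filled entries arises in two orders. The minus sign in the `just` clause of `∂` gives
  -- them opposite signs, so the mixed terms cancel.
  ∂-∂ : ∀ {n} (x : Chain n) Y → ∂ (∂ x) Y ≡ 0ℤ
  ∂-∂ x []            = refl
  ∂-∂ x (just a ∷ Y)  = cong ℤ.-_ (trans (∂-neg (∂ (x ∘ (just a ∷_))) Y)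
    (cong ℤ.-_ (∂-∂ (x ∘ (just a ∷_)) Y)))
  ∂-∂ x (nothing ∷ Y) = begin
    ∑ℤ.sum (λ g → ℤ.- ∂ (x ∘ (just g ∷_)) Y) ℤ.+
      ∂ (λ Z → ∑ℤ.sum (λ g → x (just g ∷ Z)) ℤ.+ ∂ (x ∘ (nothing ∷_)) Z) Y
      ≡⟨ cong₂ ℤ._+_ (sum-neg (λ g → ∂ (x ∘ (just g ∷_)) Y))
           (trans (∂-+ (λ Z → ∑ℤ.sum (λ g → x (just g ∷ Z))) _ Y)
             (cong₂ ℤ._+_ (∂-sum (λ g → x ∘ (just g ∷_)) Y) (∂-∂ (x ∘ (nothing ∷_)) Y))) ⟩
    ℤ.- s ℤ.+ (s ℤ.+ 0ℤ)
      ≡⟨ cancel s ⟩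
    0ℤ ∎
    where
    open ≡-Reasoning
    s : ℤ
    s = ∑ℤ.sum (λ g → ∂ (x ∘ (just g ∷_)) Y)
    cancel : ∀ a → ℤ.- a ℤ.+ (a ℤ.+ 0ℤ) ≡ 0ℤ
    cancel = ℤSolver.solve-∀

  -- Rotation permutes the `p` vertices of each factor, so the sum over fillings is only reindexed.
  ∂-rotV : ∀ {n} (x : Chain n) Y → ∂ (x ∘ rotV) Y ≡ ∂ x (rotV Y)
  ∂-rotV x []            = refl
  ∂-rotV x (nothing ∷ Y) = cong₂ ℤ._+_
    (sym (∑ℤ.sum-permute (λ g → x (just g ∷ rotV Y)) rotation)) (∂-rotV (x ∘ (nothing ∷_)) Y)
  ∂-rotV x (just a ∷ Y)  = cong ℤ.-_ (∂-rotV (x ∘ (just (rot a) ∷_)) Y)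

  -- Orbit sums and the periodic resolution

  orb : ∀ {n} → ℕ → Chain n → Chain n
  orb zero    x Y = 0ℤ
  orb (suc c) x Y = x Y ℤ.+ orb c x (rotV Y)

  orb-cong : ∀ {n} c {x y : Chain n} → x ≗ y → orb c x ≗ orb c y
  orb-cong zero    eq Y = refl
  orb-cong (suc c) eq Y = cong₂ ℤ._+_ (eq Y) (orb-cong c eq (rotV Y))

  orb-sub : ∀ {n} c (x y : Chain n) Y →
    orb c (λ Z → x Z ℤ.- y Z) Y ≡ orb c x Y ℤ.- orb c y Y
  orb-sub zero    x y Y = refl
  orb-sub (suc c) x y Y = trans
    (cong (ℤ._+_ (x Y ℤ.- y Y)) (orb-sub c x y (rotV Y))) (interchange (x Y) (y Y) _ _)
    where
    interchange : ∀ a b c d → (a ℤ.- b) ℤ.+ (c ℤ.- d) ≡ (a ℤ.+ c) ℤ.- (b ℤ.+ d)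
    interchange = ℤSolver.solve-∀

  orb-rotV : ∀ {n} c (x : Chain n) Y → orb c (x ∘ rotV) Y ≡ orb c x (rotV Y)
  orb-rotV zero    x Y = refl
  orb-rotV (suc c) x Y = cong (ℤ._+_ (x (rotV Y))) (orb-rotV c x (rotV Y))

  orb-∂ : ∀ {n} c (x : Chain n) Y → ∂ (orb c x) Y ≡ orb c (∂ x) Y
  orb-∂ zero    x Y = ∂-zero Y
  orb-∂ (suc c) x Y = trans (∂-+ x _ Y) (cong (ℤ._+_ (∂ x Y))
    (trans (∂-rotV (orb c x) Y) (orb-∂ c x (rotV Y))))

  orb-split : ∀ {n} c d (x : Chain n) Y → orb (c + d) x Y ≡ orb c x Y ℤ.+ orb d x (rotV^ c Y)
  orb-split zero    d x Y = sym (ℤP.+-identityˡ _)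
  orb-split (suc c) d x Y = trans (cong (ℤ._+_ (x Y)) (orb-split c d x (rotV Y)))
    (sym (ℤP.+-assoc (x Y) _ _))

  orb-fixed : ∀ {n} c (x : Chain n) Y → rotV Y ≡ Y → orb c x Y ≡ nat c ℤ.* x Y
  orb-fixed zero    x Y fixed = sym (ℤP.*-zeroˡ (x Y))
  orb-fixed (suc c) x Y fixed = begin
    x Y ℤ.+ orb c x (rotV Y)     ≡⟨ cong (λ Z → x Y ℤ.+ orb c x Z) fixed ⟩
    x Y ℤ.+ orb c x Y            ≡⟨ cong (ℤ._+_ (x Y)) (orb-fixed c x Y fixed) ⟩
    x Y ℤ.+ nat c ℤ.* x Y          ≡⟨ ℤP.suc-* (nat c) (x Y) ⟨
    nat (suc c) ℤ.* x Y              ∎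
    where open ≡-Reasoning

  -- The two differentials 1 − ν and 1 + ν + ⋯ + ν^(p−1) of the periodic resolution of Z_p.
  D : ∀ {n} → Bool → Chain n → Chain n
  D false x Y = x Y ℤ.- x (rotV Y)
  D true      = orb p

  D-cong : ∀ {n} b {x y : Chain n} → x ≗ y → D b x ≗ D b y
  D-cong false eq Y = cong₂ ℤ._-_ (eq Y) (eq (rotV Y))
  D-cong true  eq   = orb-cong p eq

  D-sub : ∀ {n} b (x y : Chain n) Y → D b (λ Z → x Z ℤ.- y Z) Y ≡ D b x Y ℤ.- D b y Y
  D-sub false x y Y = interchange (x Y) (y Y) (x (rotV Y)) (y (rotV Y))
    where
    interchange : ∀ a b c d → (a ℤ.- b) ℤ.- (c ℤ.- d) ≡ (a ℤ.- c) ℤ.- (b ℤ.- d)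
    interchange = ℤSolver.solve-∀
  D-sub true = orb-sub p

  D-∂ : ∀ {n} b (x : Chain n) Y → ∂ (D b x) Y ≡ D b (∂ x) Y
  D-∂ false x Y = trans (∂-sub x _ Y) (cong (ℤ._-_ (∂ x Y)) (∂-rotV x Y))
  D-∂ true      = orb-∂ p

  -- Consecutive terms cancel and leave the endpoints. After `p` rotations these coincide, which is
  -- why the norm kills `1 - ν`.
  orb-telescope : ∀ {n} c (x : Chain n) Y → orb c (D false x) Y ≡ x Y ℤ.- x (rotV^ c Y)
  orb-telescope zero    x Y = sym (ℤP.+-inverseʳ (x Y))
  orb-telescope (suc c) x Y = trans
    (cong (ℤ._+_ (x Y ℤ.- x (rotV Y))) (orb-telescope c x (rotV Y)))
    (telescope (x Y) (x (rotV Y)) _)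
    where
    telescope : ∀ a b c → (a ℤ.- b) ℤ.+ (b ℤ.- c) ≡ a ℤ.- c
    telescope = ℤSolver.solve-∀

  orb-p-D : ∀ {n} (x : Chain n) Y → orb p (D false x) Y ≡ 0ℤ
  orb-p-D x Y = trans (orb-telescope p x Y)
    (trans (cong (λ Z → x Y ℤ.- x Z) (rotV^-p Y)) (ℤP.+-inverseʳ (x Y)))

  D-D : ∀ {n} b (x : Chain n) Y → D (not b) (D b x) Y ≡ 0ℤ
  D-D false x Y = orb-p-D x Y
  D-D true  x Y = trans (cong (ℤ._-_ (orb p x Y)) (sym (orb-rotV p x Y)))
    (trans (sym (orb-sub p x (x ∘ rotV) Y)) (orb-p-D x Y))

  -- k further steps of a chain map from the periodic resolution, starting at x.
  Tower : ∀ {n} → (Chain n → Set) → Bool → ℕ → Chain n → Set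
  Tower Supp b zero    x = Supp x
  Tower Supp b (suc k) x = Supp x × ∃ λ y → (∀ Y → ∂ y Y ≡ D b x Y) × Tower Supp (not b) k y

  -- The augmentation of x is its boundary at the empty simplex.
  Unital : ∀ {n} → Chain n → Set
  Unital x = ∃ λ c → ∂ x 𝟎 ≡ 1ℤ ℤ.+ nat p ℤ.* c

  -- Towers on the full join

  lift : ∀ {n} → Chain n → Chain (suc n)
  lift x (nothing ∷ Y) = x Y
  lift x (just _ ∷ Y)  = 0ℤ

  cone : ∀ {n} → Chain n → Chain (suc n)
  cone x (nothing ∷ Y)      = 0ℤ
  cone x (just zero ∷ Y)    = x Y
  cone x (just (suc _) ∷ Y) = 0ℤ

  ∂-lift : ∀ {n} (x : Chain n) Y → ∂ (lift x) Y ≡ lift (∂ x) Y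
  ∂-lift x (nothing ∷ Y) = trans (cong (ℤ._+ ∂ x Y) (∑ℤ.sum-replicate-zero p)) (ℤP.+-identityˡ _)
  ∂-lift x (just a ∷ Y)  = cong ℤ.-_ (∂-zero Y)

  -- Deleting the apex, the vertex `zero` of the new factor, returns the base. The faces that keep
  -- the apex form a cone over `∂ x`, which is zero.
  ∂-cone : ∀ {n} (x : Chain n) → (∀ Y → ∂ x Y ≡ 0ℤ) → ∀ Y → ∂ (cone x) Y ≡ lift x Y
  ∂-cone x cycle (nothing ∷ Y)      = trans
    (cong₂ (λ a b → x Y ℤ.+ a ℤ.+ b) (∑ℤ.sum-replicate-zero P) (∂-zero Y))
    (trans (ℤP.+-identityʳ _) (ℤP.+-identityʳ _))
  ∂-cone x cycle (just zero ∷ Y)    = cong ℤ.-_ (cycle Y)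
  ∂-cone x cycle (just (suc _) ∷ Y) = cong ℤ.-_ (∂-zero Y)

  lift-cong : ∀ {n} {x y : Chain n} → x ≗ y → lift x ≗ lift y
  lift-cong eq (nothing ∷ Y) = eq Y
  lift-cong eq (just _ ∷ Y)  = refl

  orb-lift : ∀ {n} c (x : Chain n) Y → orb c (lift x) Y ≡ lift (orb c x) Y
  orb-lift zero    x (nothing ∷ Y) = refl
  orb-lift zero    x (just _ ∷ Y)  = refl
  orb-lift (suc c) x (nothing ∷ Y) = cong (ℤ._+_ (x Y)) (orb-lift c x (nothing ∷ rotV Y))
  orb-lift (suc c) x (just a ∷ Y)  =
    trans (ℤP.+-identityˡ _) (orb-lift c x (just (rot a) ∷ rotV Y))

  D-lift : ∀ {n} b (x : Chain n) Y → D b (lift x) Y ≡ lift (D b x) Y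
  D-lift false x (nothing ∷ Y) = refl
  D-lift false x (just _ ∷ Y)  = refl
  D-lift true  x Y             = orb-lift p x Y

  Anywhere : ∀ {n} → Chain n → Set
  Anywhere _ = ⊤

  lift-tower : ∀ {n} b k {x : Chain n} → Tower Anywhere b k x →
    (∀ Y → ∂ (D b x) Y ≡ 0ℤ) → Tower Anywhere b (suc k) (lift x)
  lift-tower b zero    {x} _ cycle =
    _ , cone (D b x) ,
    (λ Y → trans (∂-cone (D b x) cycle Y) (sym (D-lift b x Y))) , _
  lift-tower b (suc k) {x} (_ , y , ∂y , t) cycle =
    _ , lift y ,
    (λ Y → trans (∂-lift y Y) (trans (lift-cong ∂y Y) (sym (D-lift b x Y)))) ,
    lift-tower (not b) k t (λ Y → trans (D-∂ (not b) y Y)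
      (trans (D-cong (not b) ∂y Y) (D-D b x Y)))

  full-tower : ∀ n → ∃ λ (x : Chain (suc n)) →
    (∀ Y → ∂ (D false x) Y ≡ 0ℤ) × ∂ x 𝟎 ≡ 1ℤ × Tower Anywhere false n x
  full-tower zero = vertex , cycle , unit , _
    where
    -- The empty simplex with coefficient 1. Its cone is one vertex of Z_p, whose boundary is the
    -- empty simplex again and hence invariant under rotation.
    ∅ : Chain 0
    ∅ _ = 1ℤ
    vertex : Chain 1
    vertex = cone ∅
    ∂∅ : ∀ Y → ∂ ∅ Y ≡ 0ℤ
    ∂∅ [] = refl
    cycle : ∀ Y → ∂ (D false vertex) Y ≡ 0ℤ
    cycle Y = trans (D-∂ false vertex Y) (trans (D-cong false (∂-cone ∅ ∂∅) Y) (invariant Y))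
      where
      invariant : ∀ Y → D false (lift ∅) Y ≡ 0ℤ
      invariant (nothing ∷ []) = refl
      invariant (just _ ∷ [])  = refl
    unit : ∂ vertex 𝟎 ≡ 1ℤ
    unit = ∂-cone ∅ ∂∅ 𝟎
  full-tower (suc n) with x , cycle , unit , t ← full-tower n =
    lift x ,
    (λ Y → trans (∂-cong (D-lift false x) Y) (trans (∂-lift (D false x) Y) (lift-zero cycle Y))) ,
    trans (∂-lift x 𝟎) unit ,
    lift-tower false n t cycle
    where
    lift-zero : ∀ {m} {y : Chain m} → (∀ Y → y Y ≡ 0ℤ) → ∀ Y → lift y Y ≡ 0ℤ
    lift-zero eq (nothing ∷ Y) = eq Y
    lift-zero eq (just _ ∷ Y)  = refl

  -- Labellings and the removal of levels

  -- By `sgn-const` and `sgn-rot`, each positive level falls into pieces indexed by Z_p, with no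
  -- comparable vectors in different pieces and with rotation moving each piece to the next.
  record Labelling (n M : ℕ) : Set where
    field
      level      : SignVector p n → ℕ
      sgn        : SignVector p n → Fin p
      level≤M    : ∀ X → level X ≤ M
      level≡0    : ∀ X → level X ≡ 0 → X ≡ 𝟎
      level-mono : ∀ {X Y} → X ⊑ Y → level X ≤ level Y
      sgn-const  : ∀ {X Y} → X ⊑ Y → 0 < level X → level X ≡ level Y → sgn X ≡ sgn Y
      level-rot  : ∀ X → level (rotV X) ≡ level X
      sgn-rot    : ∀ X → 0 < level X → sgn (rotV X) ≡ rot (sgn X)

  module Descent {n M} (L : Labelling n M) where
    open Labelling L

    Supp : ℕ → Chain n → Set
    Supp j x = ∀ X → j < level X → x X ≡ 0ℤ

    -- V b, with g the sign of the simplex, is the contracting homotopy of the periodic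
    -- resolution over a free Z_p-module graded by the sign.
    V : Bool → Fin p → Chain n → Chain n
    V true  g x with g FinP.≟ el P
    ... | yes _ = x
    ... | no  _ = λ _ → 0ℤ
    V false g x = orb (P ∸ toℕ g) x

    V-∂ : ∀ b g x Y → ∂ (V b g x) Y ≡ V b g (∂ x) Y
    V-∂ true  g x Y with g FinP.≟ el P
    ... | yes _ = refl
    ... | no  _ = ∂-zero Y
    V-∂ false g x Y = orb-∂ (P ∸ toℕ g) x Y

    V-cong : ∀ b g {x y} → x ≗ y → V b g x ≗ V b g y
    V-cong true  g eq Y with g FinP.≟ el P
    ... | yes _ = eq Y
    ... | no  _ = refl
    V-cong false g eq = orb-cong (P ∸ toℕ g) eq

    orb-supp : ∀ c x j → Supp j x → Supp j (orb c x)
    orb-supp zero    x j supp Y j< = refl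
    orb-supp (suc c) x j supp Y j< = cong₂ ℤ._+_ (supp Y j<)
      (orb-supp c x j supp (rotV Y) (subst (j <_) (sym (level-rot Y)) j<))

    V-supp : ∀ b g x j → Supp j x → Supp j (V b g x)
    V-supp true  g x j supp Y j< with g FinP.≟ el P
    ... | yes _ = supp Y j<
    ... | no  _ = refl
    V-supp false g x j supp = orb-supp (P ∸ toℕ g) x j supp

    D-supp : ∀ b x j → Supp j x → Supp j (D b x)
    D-supp false x j supp X j< = cong₂ ℤ._-_ (supp X j<)
      (supp (rotV X) (subst (j <_) (sym (level-rot X)) j<))
    D-supp true  x j supp = orb-supp p x j supp

    module Stage (j : ℕ) where

      -- `V` needs a sign, and rotation changes signs. Here the homotopies for all signs are glued
      -- along level `suc j`, each simplex supplying its own.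
      W : Bool → Chain n → Chain n
      W b x X with level X ≟ suc j
      ... | yes _ = V b (sgn X) x X
      ... | no  _ = 0ℤ

      W-on : ∀ b x X → level X ≡ suc j → W b x X ≡ V b (sgn X) x X
      W-on b x X eq with level X ≟ suc j
      ... | yes _ = refl
      ... | no ≢  = contradiction eq ≢

      W-off : ∀ b x X → level X ≢ suc j → W b x X ≡ 0ℤ
      W-off b x X ≢ with level X ≟ suc j
      ... | yes eq = contradiction eq ≢
      ... | no _   = refl

      W-true-hit : ∀ x X → level X ≡ suc j → sgn X ≡ el P → W true x X ≡ x X
      W-true-hit x X on hit = trans (W-on true x X on) V-hit
        where
        V-hit : V true (sgn X) x X ≡ x X
        V-hit with sgn X FinP.≟ el P
        ... | yes _ = refl
        ... | no ≢  = contradiction hit ≢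

      W-true-miss : ∀ x X → level X ≡ suc j → sgn X ≢ el P → W true x X ≡ 0ℤ
      W-true-miss x X on miss = trans (W-on true x X on) V-miss
        where
        V-miss : V true (sgn X) x X ≡ 0ℤ
        V-miss with sgn X FinP.≟ el P
        ... | yes eq = contradiction eq miss
        ... | no _   = refl

      W-above : ∀ b x → Supp (suc j) (W b x)
      W-above b x X j< = W-off b x X (λ eq → <-irrefl (sym eq) j<)

      -- A coface of `X` on level `suc j` has the sign of `X`, and on higher cofaces both `W b x`
      -- and `V b (sgn X) x` vanish. Around `X`, therefore, `W` is `V` with one fixed sign, and that
      -- commutes with `∂`.
      ∂-W : ∀ b x → Supp (suc j) x → ∀ X → level X ≡ suc j →
        ∂ (W b x) X ≡ V b (sgn X) (∂ x) X
      ∂-W b x supp X on = trans (∂-local X agree) (V-∂ b (sgn X) x X)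
        where
        agree : ∀ Z → X ⊑ Z → Z ≢ X → W b x Z ≡ V b (sgn X) x Z
        agree Z X⊑Z _ with m≤n⇒m<n∨m≡n (level-mono X⊑Z)
        ... | inj₂ eq = trans (W-on b x Z (trans (sym eq) on))
          (cong (λ g → V b g x Z)
            (sym (sgn-const X⊑Z (subst (0 <_) (sym on) z<s) eq)))
        ... | inj₁ lt = trans (W-above b x Z suc-j<)
          (sym (V-supp b (sgn X) x (suc j) supp Z suc-j<))
          where
          suc-j< : suc j < level Z
          suc-j< = subst (_< level Z) on lt

      rotV-level : ∀ {X} → level X ≡ suc j → level (rotV X) ≡ suc j
      rotV-level on = trans (level-rot _) on

      rotV-sgn : ∀ {X} → level X ≡ suc j → sgn (rotV X) ≡ rot (sgn X)
      rotV-sgn on = sgn-rot _ (subst (0 <_) (sym on) z<s)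

      rotV-sgn-el : ∀ {X g} → level X ≡ suc j → sgn X ≡ el g → sgn (rotV X) ≡ el (suc g)
      rotV-sgn-el {g = g} on eq = trans (rotV-sgn on) (trans (cong rot eq) (el-+-el 1 g))

      rotV^-level : ∀ c {X} → level X ≡ suc j → level (rotV^ c X) ≡ suc j
      rotV^-level zero    on = on
      rotV^-level (suc c) on = rotV^-level c (rotV-level on)

      rotV^-sgn : ∀ c {X g} → level X ≡ suc j → sgn X ≡ el g → sgn (rotV^ c X) ≡ el (c + g)
      rotV^-sgn zero    on eq = eq
      rotV^-sgn (suc c) {g = g} on eq =
        trans (rotV^-sgn c (rotV-level on) (rotV-sgn-el on eq)) (cong el (+-suc c g))

      -- The rotations involved carry the signs `g` up to `g + m - 1`, all short of `P`, the only
      -- sign at which `V true` is nonzero.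
      orb-W-miss : ∀ m x X g → level X ≡ suc j → sgn X ≡ el g → g + m ≤ P →
        orb m (W true x) X ≡ 0ℤ
      orb-W-miss zero    x X g on eq le = refl
      orb-W-miss (suc m) x X g on eq le = cong₂ ℤ._+_
        (W-true-miss x X on λ hit → <⇒≢ g<P (small (trans (sym eq) hit)))
        (orb-W-miss m x (rotV X) (suc g) (rotV-level on) (rotV-sgn-el on eq)
          (subst (_≤ P) (+-suc g m) le))
        where
        g<P : g < P
        g<P = ≤-trans (m≤m+n (suc g) m) (subst (_≤ P) (+-suc g m) le)
        small : el g ≡ el P → g ≡ P
        small e = begin
          g           ≡⟨ m<n⇒m%n≡m (m<n⇒m<1+n g<P) ⟨
          g % p       ≡⟨ toℕ-el g ⟨
          toℕ (el g)  ≡⟨ cong toℕ e ⟩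
          toℕ (el P)  ≡⟨ toℕ-el P ⟩
          P % p       ≡⟨ m<n⇒m%n≡m (n<1+n P) ⟩
          P           ∎
          where open ≡-Reasoning

      -- An orbit meets the sign `P` exactly once. The orbit sum is split into the terms before that
      -- rotation, the term itself, and the terms after it.
      orb-p-W : ∀ x X → level X ≡ suc j →
        orb p (W true x) X ≡ x (rotV^ (P ∸ toℕ (sgn X)) X)
      orb-p-W x X on = begin
        orb p (W true x) X
          ≡⟨ cong (λ m → orb m (W true x) X) p≡ ⟩
        orb (c + suc g) (W true x) X
          ≡⟨ orb-split c (suc g) (W true x) X ⟩
        orb c (W true x) X ℤ.+ (W true x X′ ℤ.+ orb g (W true x) (rotV X′))
          ≡⟨ cong₂ ℤ._+_ (orb-W-miss c x X g on (sym (el-toℕ _)) (≤-reflexive g+c≡P))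
               (cong₂ ℤ._+_ (W-true-hit x X′ on′ sgn′)
                 (orb-W-miss g x (rotV X′) 0 (rotV-level on′)
                   (trans (rotV-sgn-el on′ sgn′) el-p) g≤P)) ⟩
        0ℤ ℤ.+ (x X′ ℤ.+ 0ℤ)
          ≡⟨ trans (ℤP.+-identityˡ _) (ℤP.+-identityʳ _) ⟩
        x X′ ∎
        where
        open ≡-Reasoning
        g c : ℕ
        g = toℕ (sgn X)
        c = P ∸ g
        X′ : SignVector p n
        X′ = rotV^ c X
        g≤P : g ≤ P
        g≤P = FinP.toℕ≤pred[n] (sgn X)
        g+c≡P : g + c ≡ P
        g+c≡P = m+[n∸m]≡n g≤P
        p≡ : p ≡ c + suc g
        p≡ = sym (trans (+-suc c g) (cong suc (m∸n+n≡m g≤P)))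
        on′ : level X′ ≡ suc j
        on′ = rotV^-level c on
        sgn′ : sgn X′ ≡ el P
        sgn′ = trans (rotV^-sgn c on (sym (el-toℕ _))) (cong el (m∸n+n≡m g≤P))
        el-p : el p ≡ el 0
        el-p = el-cong p 0 (n%n≡0 p)

      -- For `false`, telescoping leaves `x X` minus the value of `x` at the rotation of sign `P`,
      -- and `orb-p-W` adds that value back. For `true`, two orbit sums whose lengths differ by one
      -- leave the single term `x X`.
      homotopy : ∀ b x X → level X ≡ suc j →
        V b (sgn X) (D b x) X ℤ.+ D (not b) (W (not b) x) X ≡ x X
      homotopy false x X on = trans
        (cong₂ ℤ._+_ (orb-telescope (P ∸ toℕ (sgn X)) x X) (orb-p-W x X on))
        (cancel (x X) _)
        where
        cancel : ∀ a b → a ℤ.- b ℤ.+ b ≡ a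
        cancel = ℤSolver.solve-∀
      homotopy true x X on
        rewrite W-on false x X on
              | W-on false x (rotV X) (rotV-level on)
              | rotV-sgn on
        with sgn X FinP.≟ el P
      ... | yes eq = begin
        (x X ℤ.+ orb P x (rotV X)) ℤ.+
          (orb (P ∸ toℕ (sgn X)) x X ℤ.- orb (P ∸ toℕ (rot (sgn X))) x (rotV X))
          ≡⟨ cong₂ (λ c d → (x X ℤ.+ orb P x (rotV X)) ℤ.+ (orb c x X ℤ.- orb d x (rotV X))) c≡ d≡ ⟩
        (x X ℤ.+ orb P x (rotV X)) ℤ.+ (0ℤ ℤ.- orb P x (rotV X))
          ≡⟨ cancel (x X) _ ⟩
        x X ∎
        where
        open ≡-Reasoning
        cancel : ∀ a b → (a ℤ.+ b) ℤ.+ (0ℤ ℤ.- b) ≡ a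
        cancel = ℤSolver.solve-∀
        g≡P : toℕ (sgn X) ≡ P
        g≡P = trans (cong toℕ eq) (trans (toℕ-el P) (m<n⇒m%n≡m (n<1+n P)))
        c≡ : P ∸ toℕ (sgn X) ≡ 0
        c≡ = trans (cong (P ∸_) g≡P) (n∸n≡0 P)
        -- The sign wraps round from `P` to zero, so the sum subtracted at `rotV X` has `P` terms.
        d≡ : P ∸ toℕ (rot (sgn X)) ≡ P
        d≡ = cong (P ∸_) (trans (toℕ-el (suc (toℕ (sgn X)))) (trans (cong (λ g → suc g % p) g≡P) (n%n≡0 p)))
      ... | no neq = begin
        0ℤ ℤ.+ (orb (P ∸ toℕ (sgn X)) x X ℤ.- orb (P ∸ toℕ (rot (sgn X))) x (rotV X))
          ≡⟨ cong₂ (λ c d → 0ℤ ℤ.+ (orb c x X ℤ.- orb d x (rotV X))) c≡ d≡ ⟩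
        0ℤ ℤ.+ (x X ℤ.+ orb d x (rotV X) ℤ.- orb d x (rotV X))
          ≡⟨ cancel (x X) _ ⟩
        x X ∎
        where
        open ≡-Reasoning
        cancel : ∀ a b → 0ℤ ℤ.+ (a ℤ.+ b ℤ.- b) ≡ a
        cancel = ℤSolver.solve-∀
        g<P : toℕ (sgn X) < P
        g<P = ≤∧≢⇒< (FinP.toℕ≤pred[n] (sgn X))
          (λ e → neq (trans (sym (el-toℕ _)) (cong el e)))
        d : ℕ
        d = P ∸ suc (toℕ (sgn X))
        c≡ : P ∸ toℕ (sgn X) ≡ suc d
        c≡ = +-∸-assoc 1 g<P
        d≡ : P ∸ toℕ (rot (sgn X)) ≡ d
        d≡ = cong (P ∸_) (trans (toℕ-el (suc (toℕ (sgn X)))) (m<n⇒m%n≡m (s≤s g<P)))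

      -- The deformation of `x` along the homotopy `W`. It consults the next chain `y` of the tower,
      -- so clearing one level costs one link.
      push : Bool → Chain n → Chain n → Chain n
      push b x y X = x X ℤ.- ∂ (W b y) X ℤ.- D (not b) (W (not b) x) X

      -- Above level `suc j` all three terms vanish. On that level `∂ (W b y)` is `V` applied to
      -- `∂ y`, that is to `D b x`, and `homotopy` makes the sum zero.
      push-supp : ∀ b x y → Supp (suc j) x → Supp (suc j) y →
        (∀ Y → ∂ y Y ≡ D b x Y) → Supp j (push b x y)
      push-supp b x y sx sy ∂y X j< with m≤n⇒m<n∨m≡n j<
      ... | inj₁ lt = cong₂ ℤ._-_ (cong₂ ℤ._-_ (sx X lt) ∂W≡0)
                        (D-supp (not b) _ (suc j) (W-above (not b) x) X lt)
        where
        ∂W≡0 : ∂ (W b y) X ≡ 0ℤ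
        ∂W≡0 = trans (∂-local X (λ Z X⊑Z _ → W-above b y Z (<-≤-trans lt (level-mono X⊑Z)))) (∂-zero X)
      ... | inj₂ eq = begin
        x X ℤ.- ∂ (W b y) X ℤ.- Δ
          ≡⟨ cong (λ a → x X ℤ.- a ℤ.- Δ) (trans (∂-W b y sy X on) (V-cong b (sgn X) ∂y X)) ⟩
        x X ℤ.- V b (sgn X) (D b x) X ℤ.- Δ
          ≡⟨ cong (λ a → a ℤ.- V b (sgn X) (D b x) X ℤ.- Δ) (sym (homotopy b x X on)) ⟩
        (V b (sgn X) (D b x) X ℤ.+ Δ) ℤ.- V b (sgn X) (D b x) X ℤ.- Δ
          ≡⟨ cancel (V b (sgn X) (D b x) X) Δ ⟩
        0ℤ ∎
        where
        open ≡-Reasoning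
        on : level X ≡ suc j
        on = sym eq
        Δ : ℤ
        Δ = D (not b) (W (not b) x) X
        cancel : ∀ a b → a ℤ.+ b ℤ.- a ℤ.- b ≡ 0ℤ
        cancel = ℤSolver.solve-∀

      ∂-push : ∀ b x y Y →
        ∂ (push b x y) Y ≡ ∂ x Y ℤ.- D (not b) (∂ (W (not b) x)) Y
      ∂-push b x y Y = begin
        ∂ (push b x y) Y
          ≡⟨ trans (∂-sub (λ Z → x Z ℤ.- ∂ (W b y) Z) _ Y)
               (cong₂ ℤ._-_ (∂-sub x _ Y) (D-∂ (not b) (W (not b) x) Y)) ⟩
        ∂ x Y ℤ.- ∂ (∂ (W b y)) Y ℤ.- D (not b) (∂ (W (not b) x)) Y
          ≡⟨ cong (λ a → ∂ x Y ℤ.- a ℤ.- D (not b) (∂ (W (not b) x)) Y) (∂-∂ (W b y) Y) ⟩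
        ∂ x Y ℤ.- 0ℤ ℤ.- D (not b) (∂ (W (not b) x)) Y
          ≡⟨ cong (ℤ._- D (not b) (∂ (W (not b) x)) Y) (ℤP.+-identityʳ (∂ x Y)) ⟩
        ∂ x Y ℤ.- D (not b) (∂ (W (not b) x)) Y ∎
        where open ≡-Reasoning

      D-D′ : ∀ b (x : Chain n) Y → D b (D (not b) x) Y ≡ 0ℤ
      D-D′ false = D-D true
      D-D′ true  = D-D false

      -- On the left `∂ ∂ = 0` removes the correction by `z`; on the right `D b` kills the
      -- correction by `W (not b) x`. Both sides keep the same correction by `W b y`.
      push-link : ∀ b x y z → (∀ Y → ∂ y Y ≡ D b x Y) →
        ∀ Y → ∂ (push (not b) y z) Y ≡ D b (push b x y) Y
      push-link b x y z ∂y Y = begin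
        ∂ (push (not b) y z) Y
          ≡⟨ ∂-push (not b) y z Y ⟩
        ∂ y Y ℤ.- D (not (not b)) (∂ (W (not (not b)) y)) Y
          ≡⟨ cong₂ ℤ._-_ (∂y Y) (cong (λ c → D c (∂ (W c y)) Y) (not-involutive b)) ⟩
        D b x Y ℤ.- D b (∂ (W b y)) Y
          ≡⟨ ℤP.+-identityʳ _ ⟨
        D b x Y ℤ.- D b (∂ (W b y)) Y ℤ.- 0ℤ
          ≡⟨ cong₂ ℤ._-_ (D-sub b x _ Y) (D-D′ b (W (not b) x) Y) ⟨
        D b (λ Z → x Z ℤ.- ∂ (W b y) Z) Y ℤ.- D b (D (not b) (W (not b) x)) Y
          ≡⟨ D-sub b _ _ Y ⟨
        D b (push b x y) Y ∎
        where open ≡-Reasoning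

      push-tower : ∀ b k {x y} → Supp (suc j) x → (∀ Y → ∂ y Y ≡ D b x Y) →
        Tower (Supp (suc j)) (not b) k y → Tower (Supp j) b k (push b x y)
      push-tower b zero    {x} {y} sx ∂y sy = push-supp b x y sx sy ∂y
      push-tower b (suc k) {x} {y} sx ∂y (sy , z , ∂z , t) =
        push-supp b x y sx sy ∂y , push (not b) y z , push-link b x y z ∂y ,
        push-tower (not b) k sy ∂z t

      -- One correction is a boundary and adds nothing to the augmentation. The other is a norm, and
      -- at the empty simplex, which rotation fixes, a norm is a multiple of `p`. Hence
      -- augmentations are only tracked modulo `p`.
      push-unital : ∀ x y → Unital x → Unital (push false x y)
      push-unital x y (c , eq) = c ℤ.- w , (begin
        ∂ (push false x y) 𝟎           ≡⟨ ∂-push false x y 𝟎 ⟩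
        ∂ x 𝟎 ℤ.- orb p (∂ (W true x)) 𝟎
          ≡⟨ cong₂ ℤ._-_ eq (orb-fixed p (∂ (W true x)) 𝟎 (rotV-𝟎 n)) ⟩
        1ℤ ℤ.+ nat p ℤ.* c ℤ.- nat p ℤ.* w ≡⟨ collect (nat p) c w ⟩
        1ℤ ℤ.+ nat p ℤ.* (c ℤ.- w)       ∎)
        where
        open ≡-Reasoning
        w : ℤ
        w = ∂ (W true x) 𝟎
        collect : ∀ q a b → 1ℤ ℤ.+ q ℤ.* a ℤ.- q ℤ.* b ≡ 1ℤ ℤ.+ q ℤ.* (a ℤ.- b)
        collect = ℤSolver.solve-∀

    descend : ∀ j {x} → Unital x → Tower (Supp j) false j x → ∃ λ y → Unital y × Supp 0 y
    descend zero    {x} u s                = x , u , s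
    descend (suc j) {x} u (s , y , ∂y , t) =
      descend j (push-unital x y u) (push-tower false j s ∂y t)
      where open Stage j

    -- No simplex lies above level `M`, so the support condition is vacuous before the first stage;
    -- surplus links are dropped.
    restrict : ∀ b k m {x} → k ≤ m → Tower Anywhere b m x → Tower (Supp M) b k x
    restrict b zero    m       {x} _         _                = λ X M< → contradiction (level≤M X) (<⇒≱ M<)
    restrict b (suc k) (suc m) {x} (s≤s k≤m) (_ , y , ∂y , t) =
      (λ X M< → contradiction (level≤M X) (<⇒≱ M<)) , y , ∂y , restrict (not b) k m k≤m t

    -- A chain supported on level zero lives on the empty simplex alone, which is not a proper
    -- coface of itself. Its augmentation is therefore zero, and `p` would divide 1.
    no-unital : 1 < p → ∀ x → Unital x → ¬ Supp 0 x
    no-unital 1<p x (c , eq) supp = <⇒≢ 1<p (sym (∣1⇒≡1 p∣1))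
      where
      ∂x≡0 : ∂ x 𝟎 ≡ 0ℤ
      ∂x≡0 = trans
        (∂-local 𝟎 (λ Z _ Z≢𝟎 → supp Z (n≢0⇒n>0 (λ z → Z≢𝟎 (level≡0 Z z))))) (∂-zero (𝟎 {n = n}))
      isolate : ∀ q a → 1ℤ ≡ (1ℤ ℤ.+ q ℤ.* a) ℤ.+ ℤ.- a ℤ.* q
      isolate = ℤSolver.solve-∀
      p∣1 : p ∣ 1
      p∣1 = divides ℤ.∣ ℤ.- c ∣ (trans
        (cong ℤ.∣_∣ (begin
          1ℤ                                     ≡⟨ isolate (nat p) c ⟩
          (1ℤ ℤ.+ nat p ℤ.* c) ℤ.+ ℤ.- c ℤ.* nat p   ≡⟨ cong (ℤ._+ ℤ.- c ℤ.* nat p) (trans (sym eq) ∂x≡0) ⟩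
          0ℤ ℤ.+ ℤ.- c ℤ.* nat p                   ≡⟨ ℤP.+-identityˡ _ ⟩
          ℤ.- c ℤ.* nat p                          ∎))
        (ℤP.abs-* (ℤ.- c) (nat p)))
        where open ≡-Reasoning

  -- A join of `suc n` factors carries `n` links. If `M ≤ n`, there is a link to spend on each of
  -- the `M` levels.
  Z_p-Tucker : 1 < p → ∀ {n M} → Labelling n M → n ≤ M
  Z_p-Tucker 1<p {zero}  L = z≤n
  Z_p-Tucker 1<p {suc n} {M} L with M ≤? n
  ... | no  M≰n = ≰⇒> M≰n
  ... | yes M≤n with x , _ , unit , t ← full-tower n
                with y , u , s ← Descent.descend L M {x}
                       (0ℤ , trans unit (sym (trans (cong (ℤ._+_ 1ℤ) (ℤP.*-zeroʳ (nat p))) (ℤP.+-identityʳ 1ℤ))))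
                       (Descent.restrict L false M n M≤n t)
                = ⊥-elim (Descent.no-unital L 1<p y u s)

-- Finite sums and indicators

infix 4 _≟ₛ_
_≟ₛ_ : ∀ {r} (x y : Maybe (Fin r)) → Dec (x ≡ y)
_≟ₛ_ = MaybeP.≡-dec FinP._≟_

sum-mono-≤ : ∀ {n} {f g : Fin n → ℕ} → (∀ i → f i ≤ g i) → sum f ≤ sum g
sum-mono-≤ {zero}  f≤g = z≤n
sum-mono-≤ {suc n} f≤g = +-mono-≤ (f≤g zero) (sum-mono-≤ (f≤g ∘ suc))

sum-mono-< : ∀ {n} {f g : Fin n → ℕ} → (∀ i → f i ≤ g i) → ∀ i → f i < g i → sum f < sum g
sum-mono-< {suc n} f≤g zero    f<g = +-mono-<-≤ f<g (sum-mono-≤ (f≤g ∘ suc))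
sum-mono-< {suc n} f≤g (suc i) f<g = +-mono-≤-< (f≤g zero) (sum-mono-< (f≤g ∘ suc) i f<g)

sum-bump : ∀ {n} {f g : Fin n → ℕ} i₀ → (∀ i → i ≢ i₀ → f i ≤ g i) → f i₀ ≤ suc (g i₀) →
  sum f ≤ suc (sum g)
sum-bump {suc n} zero     rest at-i₀ = +-mono-≤ at-i₀ (sum-mono-≤ (λ i → rest (suc i) λ ()))
sum-bump {suc n} (suc i₀) rest at-i₀ = ≤-trans
  (+-mono-≤ (rest zero λ ()) (sum-bump i₀ (λ i i≢ → rest (suc i) (i≢ ∘ FinP.suc-injective)) at-i₀))
  (≤-reflexive (+-suc _ _))

sum-injective : ∀ {n} {f g : Fin n → ℕ} → (∀ i → f i ≤ g i) → sum f ≡ sum g → f ≗ g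
sum-injective f≤g eq i with m≤n⇒m<n∨m≡n (f≤g i)
... | inj₁ lt  = contradiction eq (<⇒≢ (sum-mono-< f≤g i lt))
... | inj₂ f≡g = f≡g

sum-const : ∀ n c → sum {n} (λ _ → c) ≡ n * c
sum-const zero    c = refl
sum-const (suc n) c = cong (c +_) (sum-const n c)

≤-sum : ∀ {n} (f : Fin n → ℕ) i → f i ≤ sum f
≤-sum {suc n} f zero    = m≤m+n _ _
≤-sum {suc n} f (suc i) = ≤-trans (≤-sum (f ∘ suc) i) (m≤n+m _ _)

sum-*ʳ : ∀ {n} (f : Fin n → ℕ) c → sum (λ i → f i * c) ≡ sum f * c
sum-*ʳ {zero}  f c = refl
sum-*ʳ {suc n} f c = trans (cong (f zero * c +_) (sum-*ʳ (f ∘ suc) c))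
  (sym (*-distribʳ-+ c (f zero) _))

module _ {A : Set} where

  indicator : Dec A → ℕ
  indicator (yes _) = 1
  indicator (no _)  = 0

  indicator-yes : (A? : Dec A) → A → indicator A? ≡ 1
  indicator-yes (yes _) a = refl
  indicator-yes (no ¬a) a = contradiction a ¬a

  indicator-no : (A? : Dec A) → ¬ A → indicator A? ≡ 0
  indicator-no (yes a) ¬a = contradiction a ¬a
  indicator-no (no _)  ¬a = refl

  indicator≤1 : (A? : Dec A) → indicator A? ≤ 1
  indicator≤1 (yes _) = ≤-refl
  indicator≤1 (no _)  = z≤n

indicator-mono : ∀ {A B : Set} (A? : Dec A) (B? : Dec B) → (A → B) → indicator A? ≤ indicator B?
indicator-mono (yes a) B? f = ≤-reflexive (sym (indicator-yes B? (f a)))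
indicator-mono (no _)  B? f = z≤n

-- Runs and classes of sign vectors

module _ {r : ℕ} where

  -- Greedy form of altFrom.
  runs : ∀ {n} → Maybe (Fin r) → SignVector r n → ℕ
  runs l []            = 0
  runs l (nothing ∷ X) = runs l X
  runs l (just a ∷ X) with l ≟ₛ just a
  ... | yes _ = runs l X
  ... | no  _ = suc (runs (just a) X)

  runs-same : ∀ {n} a (X : SignVector r n) → runs (just a) (just a ∷ X) ≡ runs (just a) X
  runs-same a X with just a ≟ₛ just a
  ... | yes _ = refl
  ... | no ≢  = contradiction refl ≢

  runs-new : ∀ {n l} a (X : SignVector r n) → l ≢ just a →
    runs l (just a ∷ X) ≡ suc (runs (just a) X)
  runs-new {l = l} a X l≢a with l ≟ₛ just a
  ... | yes eq = contradiction eq l≢a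
  ... | no _   = refl

  -- The remembered sign only decides whether the first run counts as new. This bound justifies the
  -- greedy choice: skipping an entry gains no more than the one run that taking it adds.
  runs-shift : ∀ {n} l l′ (X : SignVector r n) → runs l X ≤ suc (runs l′ X)
  runs-shift l l′ []            = z≤n
  runs-shift l l′ (nothing ∷ X) = runs-shift l l′ X
  runs-shift l l′ (just a ∷ X) with l ≟ₛ just a | l′ ≟ₛ just a
  ... | yes refl | yes refl = n≤1+n _
  ... | yes refl | no _     = m≤n⇒m≤1+n (n≤1+n _)
  ... | no _     | yes refl = ≤-refl
  ... | no _     | no _     = n≤1+n _

  runs-∷-≤ : ∀ {n} l a (X : SignVector r n) → runs l (just a ∷ X) ≤ suc (runs (just a) X)
  runs-∷-≤ l a X with l ≟ₛ just a
  ... | yes refl = n≤1+n _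
  ... | no _     = ≤-refl

  runs-≤-∷ : ∀ {n} l x (X : SignVector r n) → runs l X ≤ runs l (x ∷ X)
  runs-≤-∷ l nothing  X = ≤-refl
  runs-≤-∷ l (just a) X with l ≟ₛ just a
  ... | yes _ = ≤-refl
  ... | no _  = runs-shift l (just a) X

  runs-mono : ∀ {n} l {X Y : SignVector r n} → X ⊑ Y → runs l X ≤ runs l Y
  runs-mono l []                      = z≤n
  runs-mono l (skip {y = y} X⊑Y)      = ≤-trans (runs-mono l X⊑Y) (runs-≤-∷ l y _)
  runs-mono l (keep {x = nothing} X⊑Y) = runs-mono l X⊑Y
  runs-mono l (keep {x = just a} X⊑Y) with l ≟ₛ just a
  ... | yes _ = runs-mono l X⊑Y
  ... | no _  = s≤s (runs-mono (just a) X⊑Y)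

  nonzeros : ∀ {n} → SignVector r n → ℕ
  nonzeros []            = 0
  nonzeros (nothing ∷ X) = nonzeros X
  nonzeros (just _ ∷ X)  = suc (nonzeros X)

  runs≤nonzeros : ∀ {n} l (X : SignVector r n) → runs l X ≤ nonzeros X
  runs≤nonzeros l []            = z≤n
  runs≤nonzeros l (nothing ∷ X) = runs≤nonzeros l X
  runs≤nonzeros l (just a ∷ X)  = ≤-trans (runs-∷-≤ l a X) (s≤s (runs≤nonzeros (just a) X))

  runs≡0 : ∀ {n} (X : SignVector r n) → runs nothing X ≡ 0 → X ≡ 𝟎
  runs≡0 []            _  = refl
  runs≡0 (nothing ∷ X) eq = cong (nothing ∷_) (runs≡0 X eq)

  class : ∀ {n} → SignVector r n → Fin r → Subset n
  class X i = Vec.map (λ x → ⌊ x ≟ₛ just i ⌋) X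

  ∈-class⁺ : ∀ {n} (X : SignVector r n) i {v} → lookup X v ≡ just i → v ∈ class X i
  ∈-class⁺ X i {v} eq = VecP.lookup⇒[]= v _ (trans (VecP.lookup-map v _ X) isYes)
    where
    isYes : ⌊ lookup X v ≟ₛ just i ⌋ ≡ true
    isYes with lookup X v ≟ₛ just i
    ... | yes _ = refl
    ... | no ≢  = contradiction eq ≢

  ∈-class⁻ : ∀ {n} (X : SignVector r n) i {v} → v ∈ class X i → lookup X v ≡ just i
  ∈-class⁻ X i {v} v∈ = isYes (trans (sym (VecP.lookup-map v _ X)) (VecP.[]=⇒lookup v∈))
    where
    isYes : ⌊ lookup X v ≟ₛ just i ⌋ ≡ true → lookup X v ≡ just i
    isYes _ with lookup X v ≟ₛ just i
    ... | yes eq = eq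

  ⊑-lookup : ∀ {n} {X Y : SignVector r n} {i} → X ⊑ Y → ∀ v →
    lookup X v ≡ just i → lookup Y v ≡ just i
  ⊑-lookup (keep X⊑Y) zero    eq = eq
  ⊑-lookup (skip X⊑Y) (suc v) eq = ⊑-lookup X⊑Y v eq
  ⊑-lookup (keep X⊑Y) (suc v) eq = ⊑-lookup X⊑Y v eq

  class-mono : ∀ {n} {X Y : SignVector r n} i → X ⊑ Y → class X i ⊆ class Y i
  class-mono {X = X} {Y} i X⊑Y {v} v∈ = ∈-class⁺ Y i (⊑-lookup X⊑Y v (∈-class⁻ X i v∈))

  class-𝟎 : ∀ {n} i {S : Subset n} → class 𝟎 i ⊆ S
  class-𝟎 i {x = v} v∈ with () ←
    trans (sym (VecP.lookup-replicate v nothing)) (∈-class⁻ 𝟎 i v∈)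

  -- Exhaustive search decides both alternatives of `Dichotomy`, which makes the argument by
  -- contradiction constructive.
  ∃-signVector? : ∀ {n} {Q : SignVector r n → Set} → (∀ X → Dec (Q X)) → Dec (∃ Q)
  ∃-signVector? {zero}  Q? = map′ ([] ,_) (λ { ([] , q) → q }) (Q? [])
  ∃-signVector? {suc n} Q? = map′
    (λ { (inj₁ (X , q)) → nothing ∷ X , q ; (inj₂ (a , X , q)) → just a ∷ X , q })
    (λ { (nothing ∷ X , q) → inj₁ (X , q) ; (just a ∷ X , q) → inj₂ (a , X , q) })
    (∃-signVector? (Q? ∘ (nothing ∷_)) ⊎-dec
      FinP.any? (λ a → ∃-signVector? (Q? ∘ (just a ∷_))))

-- The dichotomy for monotone families

Dichotomy : ℕ → Set₁
Dichotomy r = ∀ {n k} (F : Fin k → Subset n → Set) →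
  (∀ j S → Dec (F j S)) → (∀ j {S S′} → S ⊆ S′ → F j S → F j S′) →
  (∃ λ j → ∃ λ (X : SignVector r n) → ∀ i → F j (class X i)) ⊎
  (∃ λ (X : SignVector r n) → (∀ j i → ¬ F j (class X i)) × n ≤ runs nothing X + (r ∸ 1) * k)

-- A prime number of signs

module PrimeCase (P : ℕ) (p-prime : Prime (suc P)) where
  open Cyclic P

  first : ∀ {n} → SignVector p n → Fin p
  first []            = zero
  first (nothing ∷ X) = first X
  first (just a ∷ X)  = a

  runs-first : ∀ {n} b (X : SignVector p n) → first X ≢ b → runs (just b) X ≡ runs nothing X
  runs-first b []            _  = refl
  runs-first b (nothing ∷ X) ≢b = runs-first b X ≢b
  runs-first b (just a ∷ X)  ≢b = runs-new a X (≢b ∘ sym ∘ MaybeP.just-injective)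

  -- A nonzero entry of `Y` in front of `X` that differs from the first sign of `X` would open an
  -- additional run, and the counts could not agree.
  first-const : ∀ {n} {X Y : SignVector p n} → X ⊑ Y →
    runs nothing X ≡ runs nothing Y → 0 < runs nothing X → first X ≡ first Y
  first-const (skip {y = nothing} X⊑Y) eq pos = first-const X⊑Y eq pos
  first-const (keep {x = nothing} X⊑Y) eq pos = first-const X⊑Y eq pos
  first-const (keep {x = just a} X⊑Y)  eq pos = refl
  first-const (skip {X = X} {Y} {y = just b} X⊑Y) eq pos with first X FinP.≟ b
  ... | yes first≡b = first≡b
  ... | no  first≢b = contradiction eq (<⇒≢ (begin-strict
    runs nothing X       ≡⟨ runs-first b X first≢b ⟨
    runs (just b) X      ≤⟨ runs-mono (just b) X⊑Y ⟩
    runs (just b) Y      <⟨ n<1+n _ ⟩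
    suc (runs (just b) Y) ∎))
    where open ≤-Reasoning

  first-rot : ∀ {n} (X : SignVector p n) → 0 < runs nothing X → first (rotV X) ≡ rot (first X)
  first-rot (nothing ∷ X) pos = first-rot X pos
  first-rot (just a ∷ X)  pos = refl

  runs-rot : ∀ {n} l (X : SignVector p n) → runs (Maybe.map rot l) (rotV X) ≡ runs l X
  runs-rot l []            = refl
  runs-rot l (nothing ∷ X) = runs-rot l X
  runs-rot l (just a ∷ X) with l ≟ₛ just a
  ... | yes refl = trans (runs-same (rot a) (rotV X)) (runs-rot (just a) X)
  ... | no l≢a   = trans (runs-new (rot a) (rotV X) (l≢a ∘ MaybeP.map-injective rot-injective))
                     (cong suc (runs-rot (just a) X))

  class-rot : ∀ {n} (X : SignVector p n) i → class (rotV X) (rot i) ≡ class X i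
  class-rot X i = ⊆-antisym
    (λ {v} v∈ → ∈-class⁺ X i (MaybeP.map-injective rot-injective
      (trans (sym (VecP.lookup-map v _ X)) (∈-class⁻ (rotV X) (rot i) v∈))))
    (λ {v} v∈ → ∈-class⁺ (rotV X) (rot i)
      (trans (VecP.lookup-map v _ X) (cong (Maybe.map rot) (∈-class⁻ X i v∈))))

  inverse : ℕ → ℕ
  inverse c with Bézout.identity (gcd-GCD c p)
  ... | Bézout.+- x _ _ = x
  -- In this case `x` is minus an inverse, and `P` is -1 modulo `p`.
  ... | Bézout.-+ x _ _ = P * x

  -- Primality enters here: every nonzero mass below `p` is invertible. The congruence has multiples
  -- of `p` on both sides in order to stay in ℕ.
  inverse-* : ∀ c → 0 < c → c < p → ∃ λ u → ∃ λ v → inverse c * c + u * p ≡ 1 + v * p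
  inverse-* c@(suc _) _ c<p with Bézout.identity (gcd-GCD c p) | gcd≡1
    where
    gcd≡1 : gcd c p ≡ 1
    gcd≡1 = trans (gcd-comm c p) (coprime⇒gcd≡1 (prime⇒coprime p-prime c<p))
  ... | Bézout.+- x y eq | g = 0 , y , trans (+-identityʳ _) (trans (sym eq) (cong (_+ y * p) g))
  ... | Bézout.-+ x y eq | g = 1 , P * y , (begin
    P * x * c + 1 * p          ≡⟨ regroup P x c ⟩
    1 + P * (1 + x * c)        ≡⟨ cong (λ z → 1 + P * z) (trans (cong (_+ x * c) (sym g)) eq) ⟩
    1 + P * (y * p)            ≡⟨ cong suc (sym (*-assoc P y p)) ⟩
    1 + P * y * p              ∎)
    where
    open ≡-Reasoning
    regroup : ∀ P x c → P * x * c + 1 * suc P ≡ 1 + P * (1 + x * c)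
    regroup = ℕSolver.solve-∀

  -- The centre of mass of w; dividing by its total mass is what makes it equivariant.
  centre : (Fin p → ℕ) → Fin p
  centre w = el (inverse (sum w) * sum (λ i → w i * toℕ i))

  centre-cong : ∀ {w w′} → w ≗ w′ → centre w ≡ centre w′
  centre-cong eq = cong₂ (λ c t → el (inverse c * t))
    (∑ℕ.sum-cong-≗ eq) (∑ℕ.sum-cong-≗ (λ i → cong (_* toℕ i) (eq i)))

  sum-rot : ∀ {w w′ : Fin p → ℕ} → (∀ i → w′ (rot i) ≡ w i) → sum w′ ≡ sum w
  sum-rot {w} {w′} eq = trans (∑ℕ.sum-permute w′ rotation) (∑ℕ.sum-cong-≗ eq)

  -- Rotation moves each unit of mass one step, so the moment grows by the total mass modulo `p`;
  -- the inverse of the mass turns this into a shift by 1.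
  centre-rot : ∀ {w w′} → (∀ i → w′ (rot i) ≡ w i) → 0 < sum w → sum w < p →
    centre w′ ≡ rot (centre w)
  centre-rot {w} {w′} eq 0<c c<p with u , v , inv ← inverse-* (sum w) 0<c c<p = begin
    el (inverse (sum w′) * t′)         ≡⟨ cong (λ z → el (inverse z * t′)) (sum-rot {w} {w′} eq) ⟩
    el (ι * t′)                        ≡⟨ el-+-* (ι * t′) (ι * e + u) ⟨
    el (ι * t′ + (ι * e + u) * p)      ≡⟨ cong el (regroup ι t′ e u p) ⟩
    el (ι * (t′ + e * p) + u * p)      ≡⟨ cong (λ z → el (ι * z + u * p)) moment ⟨
    el (ι * (t + sum w) + u * p)       ≡⟨ cong el (regroup′ ι t (sum w) (u * p)) ⟩
    el (ι * t + (ι * sum w + u * p))   ≡⟨ cong (λ z → el (ι * t + z)) inv ⟩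
    el (ι * t + (1 + v * p))           ≡⟨ cong el (regroup″ (ι * t) (v * p)) ⟩
    el (1 + ι * t + v * p)             ≡⟨ el-+-* (1 + ι * t) v ⟩
    el (1 + ι * t)                     ≡⟨ el-+-el 1 (ι * t) ⟨
    rot (el (ι * t))                   ∎
    where
    open ≡-Reasoning
    ι t t′ e : ℕ
    ι  = inverse (sum w)
    t  = sum (λ i → w i * toℕ i)
    t′ = sum (λ i → w′ i * toℕ i)
    -- The mass that wraps round from `P` to zero; each unit of it loses `p` from the moment.
    e  = sum (λ i → w i * (suc (toℕ i) / p))
    regroup : ∀ a b c d q → a * b + (a * c + d) * q ≡ a * (b + c * q) + d * q
    regroup = ℕSolver.solve-∀
    regroup′ : ∀ a b c d → a * (b + c) + d ≡ a * b + (a * c + d)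
    regroup′ = ℕSolver.solve-∀
    regroup″ : ∀ a b → a + (1 + b) ≡ 1 + a + b
    regroup″ = ℕSolver.solve-∀
    term : ∀ i → w i * toℕ i + w i ≡ w′ (rot i) * toℕ (rot i) + w i * (suc (toℕ i) / p) * p
    term i = begin
      w i * toℕ i + w i
        ≡⟨ trans (+-comm _ (w i)) (sym (*-suc (w i) (toℕ i))) ⟩
      w i * suc (toℕ i)
        ≡⟨ cong (w i *_) (m≡m%n+[m/n]*n (suc (toℕ i)) p) ⟩
      w i * (suc (toℕ i) % p + suc (toℕ i) / p * p)
        ≡⟨ *-distribˡ-+ (w i) (suc (toℕ i) % p) _ ⟩
      w i * (suc (toℕ i) % p) + w i * (suc (toℕ i) / p * p)
        ≡⟨ cong₂ _+_ (cong₂ _*_ (sym (eq i)) (sym (toℕ-el (suc (toℕ i)))))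
             (sym (*-assoc (w i) (suc (toℕ i) / p) p)) ⟩
      w′ (rot i) * toℕ (rot i) + w i * (suc (toℕ i) / p) * p ∎
    moment : t + sum w ≡ t′ + e * p
    moment = begin
      t + sum w
        ≡⟨ ∑ℕ.∑-distrib-+ (λ i → w i * toℕ i) w ⟨
      sum (λ i → w i * toℕ i + w i)
        ≡⟨ ∑ℕ.sum-cong-≗ term ⟩
      sum (λ i → w′ (rot i) * toℕ (rot i) + w i * (suc (toℕ i) / p) * p)
        ≡⟨ ∑ℕ.∑-distrib-+ (λ i → w′ (rot i) * toℕ (rot i)) (λ i → w i * (suc (toℕ i) / p) * p) ⟩
      sum (λ i → w′ (rot i) * toℕ (rot i)) + sum (λ i → w i * (suc (toℕ i) / p) * p)
        ≡⟨ cong₂ _+_ (sym (∑ℕ.sum-permute (λ i → w′ i * toℕ i) rotation))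
             (sum-*ʳ (λ i → w i * (suc (toℕ i) / p)) p) ⟩
      t′ + e * p ∎

  ifZero : ℕ → Fin p → Fin p → Fin p
  ifZero zero    x y = x
  ifZero (suc _) x y = y

  ifZero-rot : ∀ c {x x′ y y′} → (c ≡ 0 → x′ ≡ rot x) → (0 < c → y′ ≡ rot y) →
    ifZero c x′ y′ ≡ rot (ifZero c x y)
  ifZero-rot zero    eq₀ eq₊ = eq₀ refl
  ifZero-rot (suc _) eq₀ eq₊ = eq₊ z<s

  pick : ∀ {k} → (Fin k → Fin p → ℕ) → Fin p
  -- This default is reached only when all masses vanish, which `pick-rot` excludes by positivity.
  pick {zero}  w = zero
  pick {suc k} w = ifZero (sum (w zero)) (pick (w ∘ suc)) (centre (w zero))

  pick-cong : ∀ {k} {w w′ : Fin k → Fin p → ℕ} → (∀ j → w j ≗ w′ j) → pick w ≡ pick w′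
  pick-cong {zero}           eq = refl
  pick-cong {suc k} {w} {w′} eq = trans
    (cong (λ c → ifZero c (pick (w ∘ suc)) (centre (w zero))) (∑ℕ.sum-cong-≗ (eq zero)))
    (cong₂ (ifZero (sum (w′ zero))) (pick-cong (eq ∘ suc)) (centre-cong {w zero} {w′ zero} (eq zero)))

  pick-rot : ∀ {k} {w w′ : Fin k → Fin p → ℕ} → (∀ j i → w′ j (rot i) ≡ w j i) →
    (∀ j → sum (w j) < p) → 0 < sum (λ j → sum (w j)) → pick w′ ≡ rot (pick w)
  pick-rot {suc k} {w} {w′} eq <p pos = trans
    (cong (λ c → ifZero c (pick (w′ ∘ suc)) (centre (w′ zero))) (sum-rot {w zero} {w′ zero} (eq zero)))
    (ifZero-rot (sum (w zero))
      (λ c≡0 → pick-rot {w = w ∘ suc} {w′ ∘ suc} (eq ∘ suc) (<p ∘ suc)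
        (subst (λ c → 0 < c + sum (λ j → sum (w (suc j)))) c≡0 pos))
      (λ 0<c → centre-rot {w zero} {w′ zero} (eq zero) 0<c (<p zero)))

  module _ {n k} (F : Fin k → Subset n → Set) (F? : ∀ j S → Dec (F j S))
    (F-mono : ∀ j {S S′} → S ⊆ S′ → F j S → F j S′)
    (no-F : ∀ j (X : SignVector p n) → ¬ (∀ i → F j (class X i)))
    (a : ℕ) (dense : ∀ (X : SignVector p n) → a < runs nothing X → ∃ λ j → ∃ λ i → F j (class X i))
    where

    weight : SignVector p n → Fin k → Fin p → ℕ
    weight X j i = indicator (F? j (class X i))

    weight-mono : ∀ {X Y} → X ⊑ Y → ∀ j i → weight X j i ≤ weight Y j i
    weight-mono {X} {Y} X⊑Y j i =
      indicator-mono (F? j (class X i)) (F? j (class Y i)) (F-mono j (class-mono i X⊑Y))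

    weight-rot : ∀ X j i → weight (rotV X) j (rot i) ≡ weight X j i
    weight-rot X j i = cong (λ S → indicator (F? j S)) (class-rot X i)

    -- By `no-F` some class is outside `F j`. The bound serves twice: it limits the levels to
    -- `a + k * P` and makes nonzero masses invertible.
    weight-sum : ∀ X j → sum (weight X j) < p
    weight-sum X j with i , ¬f ← FinP.¬∀⟶∃¬ p _ (λ i → F? j (class X i)) (no-F j X) =
      subst (sum (weight X j) <_) (trans (sum-const p 1) (*-identityʳ p))
        (sum-mono-< (λ i → indicator≤1 (F? j (class X i))) i
          (subst (_< 1) (sym (indicator-no (F? j (class X i)) ¬f)) z<s))

    total : SignVector p n → ℕ
    total X = sum (λ j → sum (weight X j))

    total-mono : ∀ {X Y} → X ⊑ Y → total X ≤ total Y
    total-mono X⊑Y = sum-mono-≤ (λ j → sum-mono-≤ (weight-mono X⊑Y j))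

    total-pos : ∀ X → a < runs nothing X → 0 < total X
    total-pos X a< with j , i , f ← dense X a< = begin
      1                  ≡⟨ indicator-yes (F? j (class X i)) f ⟨
      weight X j i       ≤⟨ ≤-sum (weight X j) i ⟩
      sum (weight X j)   ≤⟨ ≤-sum (λ j → sum (weight X j)) j ⟩
      total X            ∎
      where open ≤-Reasoning

    -- Past the threshold `a`, `total` is positive by `dense`, so the levels of the two regimes
    -- never coincide and signs need comparing only within one regime.
    level : SignVector p n → ℕ
    level X with runs nothing X ≤? a
    ... | yes _ = runs nothing X
    ... | no  _ = a + total X

    sgn : SignVector p n → Fin p
    sgn X with runs nothing X ≤? a
    ... | yes _ = first X
    ... | no  _ = pick (weight X)

    labelling : Labelling n (a + k * P)
    labelling = record
      { level      = level
      ; sgn        = sgn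
      ; level≤M    = level≤M
      ; level≡0    = level≡0
      ; level-mono = level-mono
      ; sgn-const  = sgn-const
      ; level-rot  = level-rot
      ; sgn-rot    = sgn-rot
      }
      where
      level≤M : ∀ X → level X ≤ a + k * P
      level≤M X with runs nothing X ≤? a
      ... | yes r≤a = ≤-trans r≤a (m≤m+n a _)
      ... | no  _   = +-monoʳ-≤ a (≤-trans (sum-mono-≤ (λ j → s≤s⁻¹ (weight-sum X j)))
                        (≤-reflexive (sum-const k P)))

      level≡0 : ∀ X → level X ≡ 0 → X ≡ 𝟎
      level≡0 X eq with runs nothing X ≤? a
      ... | yes _   = runs≡0 X eq
      ... | no  r≰a = contradiction (m+n≡0⇒n≡0 a eq) (>⇒≢ (total-pos X (≰⇒> r≰a)))

      level-mono : ∀ {X Y} → X ⊑ Y → level X ≤ level Y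
      level-mono {X} {Y} X⊑Y with runs nothing X ≤? a | runs nothing Y ≤? a
      ... | yes _   | yes _   = runs-mono nothing X⊑Y
      ... | yes r≤a | no  _   = ≤-trans r≤a (m≤m+n a _)
      ... | no  r≰a | yes r≤a = contradiction (≤-trans (runs-mono nothing X⊑Y) r≤a) r≰a
      ... | no  _   | no  _   = +-monoʳ-≤ a (total-mono X⊑Y)

      sgn-const : ∀ {X Y} → X ⊑ Y → 0 < level X → level X ≡ level Y → sgn X ≡ sgn Y
      sgn-const {X} {Y} X⊑Y pos eq with runs nothing X ≤? a | runs nothing Y ≤? a
      ... | yes _   | yes _   = first-const X⊑Y eq pos
      ... | yes r≤a | no  r≰a = contradiction eq (<⇒≢ (≤-<-trans r≤a
                                  (m<m+n a (total-pos Y (≰⇒> r≰a)))))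
      ... | no  r≰a | yes r≤a = contradiction (≤-trans (runs-mono nothing X⊑Y) r≤a) r≰a
      -- Equal totals of termwise ordered weights force equal weights, so `pick` receives the same
      -- data.
      ... | no  _   | no  _   = pick-cong (λ j → sum-injective (weight-mono X⊑Y j)
        (sum-injective (λ j → sum-mono-≤ (weight-mono X⊑Y j)) (+-cancelˡ-≡ a _ _ eq) j))

      level-rot : ∀ X → level (rotV X) ≡ level X
      level-rot X with runs nothing (rotV X) ≤? a | runs nothing X ≤? a
      ... | yes _   | yes _   = runs-rot nothing X
      ... | yes r≤a | no  r≰a = contradiction (subst (_≤ a) (runs-rot nothing X) r≤a) r≰a
      ... | no  r≰a | yes r≤a = contradiction (subst (_≤ a) (sym (runs-rot nothing X)) r≤a) r≰a
      ... | no  _   | no  _   = cong (a +_) (∑ℕ.sum-cong-≗ (λ j →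
        sum-rot {weight X j} {weight (rotV X) j} (weight-rot X j)))

      sgn-rot : ∀ X → 0 < level X → sgn (rotV X) ≡ rot (sgn X)
      sgn-rot X pos with runs nothing (rotV X) ≤? a | runs nothing X ≤? a
      ... | yes _   | yes _   = first-rot X pos
      ... | yes r≤a | no  r≰a = contradiction (subst (_≤ a) (runs-rot nothing X) r≤a) r≰a
      ... | no  r≰a | yes r≤a = contradiction (subst (_≤ a) (sym (runs-rot nothing X)) r≤a) r≰a
      ... | no  _   | no  r≰a = pick-rot (weight-rot X) (weight-sum X) (total-pos X (≰⇒> r≰a))

  dichotomy-prime : Dichotomy p
  dichotomy-prime {n} {k} F F? F-mono
    with FinP.any? (λ j → ∃-signVector? (λ X → FinP.all? (λ i → F? j (class X i))))
  ... | yes found = inj₁ found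
  ... | no  no-F
    with ∃-signVector? {n = n} (λ X →
           FinP.all? (λ j → FinP.all? (λ i → ¬? (F? j (class X i)))) ×-dec
           n ≤? runs nothing X + P * k)
  ... | yes sparse = inj₂ sparse
  ... | no  none   = contradiction
    (Z_p-Tucker (nonTrivial⇒n>1 p {{prime⇒nonTrivial p-prime}})
      (labelling F F? F-mono (λ j X f → no-F (j , X , f)) a dense))
    (<⇒≱ (≤-reflexive (trans (cong (λ z → suc (a + z)) (*-comm k P))
      (trans (sym (+-suc a _)) (m∸n+n≡m Pk<n)))))
    where
    a : ℕ
    -- Chosen so that `a + k * P` is `n - 1`, one level too few for `Z_p-Tucker`, while more than
    -- `a` runs means at least `n - P * k`.
    a = n ∸ suc (P * k)
    Pk<n : P * k < n
    -- Otherwise `𝟎` realises the second alternative: its classes are empty, and if one were in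
    -- `F j`, all would be, giving the first alternative.
    Pk<n = ≰⇒> (λ n≤ → none (𝟎 ,
      (λ j i f → no-F (j , 𝟎 , λ i′ → F-mono j (class-𝟎 i) f)) ,
      ≤-trans n≤ (m≤n+m _ _)))
    dense : ∀ X → a < runs nothing X → ∃ λ j → ∃ λ i → F j (class X i)
    dense X a< with FinP.any? (λ j → FinP.any? (λ i → F? j (class X i)))
    ... | yes found = found
    ... | no  miss  = contradiction
      (X , (λ j i f → miss (j , i , f)) , (begin
        n                           ≡⟨ m∸n+n≡m Pk<n ⟨
        a + suc (P * k)             ≡⟨ +-suc a (P * k) ⟩
        suc a + P * k               ≤⟨ +-monoˡ-≤ (P * k) a< ⟩
        runs nothing X + P * k      ∎)) none
      where open ≤-Reasoning

-- Substitution and a composite number of signs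

tail-lookup : ∀ {A : Set} {n} {v} (V : Vec A (suc n)) → lookup (tail V) v ≡ lookup V (suc v)
tail-lookup (_ ∷ _) = refl

module _ {p s : ℕ} where

  glue : Maybe (Fin p) → (Fin p → Maybe (Fin s)) → Maybe (Fin (p * s))
  glue nothing  y = nothing
  glue (just i) y = Maybe.map (combine i) (y i)

  glue-cong : ∀ x {y y′} → y ≗ y′ → glue x y ≡ glue x y′
  glue-cong nothing  eq = refl
  glue-cong (just i) eq = cong (Maybe.map (combine i)) (eq i)

  substitute : ∀ {n} → SignVector p n → (Fin p → SignVector s n) → SignVector (p * s) n
  substitute []      Y = []
  substitute (x ∷ X) Y = glue x (head ∘ Y) ∷ substitute X (tail ∘ Y)

  lookup-substitute : ∀ {n} (X : SignVector p n) Y v →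
    lookup (substitute X Y) v ≡ glue (lookup X v) (λ i → lookup (Y i) v)
  lookup-substitute (x ∷ X) Y zero    = glue-cong x (λ i → head-lookup (Y i))
    where
    head-lookup : ∀ {A : Set} {n} (V : Vec A (suc n)) → head V ≡ lookup V zero
    head-lookup (_ ∷ _) = refl
  lookup-substitute (x ∷ X) Y (suc v) = trans (lookup-substitute X (tail ∘ Y) v)
    (glue-cong (lookup X v) (λ i → tail-lookup (Y i)))

  class-substitute-⊇ : ∀ {n} (X : SignVector p n) Y i m →
    class (Y i) m ∩ class X i ⊆ class (substitute X Y) (combine i m)
  class-substitute-⊇ X Y i m {v} v∈ with v∈Y , v∈X ← x∈p∩q⁻ (class (Y i) m) (class X i) v∈ =
    ∈-class⁺ (substitute X Y) (combine i m) (trans (lookup-substitute X Y v)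
      (trans (cong (λ x → glue x (λ i → lookup (Y i) v)) (∈-class⁻ X i v∈X))
        (cong (Maybe.map (combine i)) (∈-class⁻ (Y i) m v∈Y))))

  unglue : ∀ i m x {y} → glue x y ≡ just (combine i m) → x ≡ just i × y i ≡ just m
  unglue i m (just i′) {y} eq with y i′ in y≡
  ... | just m′ with refl , refl ← FinP.combine-injective i′ m′ i m (MaybeP.just-injective eq) =
    refl , y≡

  class-substitute-⊆ : ∀ {n} (X : SignVector p n) Y i m →
    class (substitute X Y) (combine i m) ⊆ class (Y i) m
  class-substitute-⊆ X Y i m {v} v∈ = ∈-class⁺ (Y i) m (proj₂ (unglue i m (lookup X v)
    (trans (sym (lookup-substitute X Y v)) (∈-class⁻ (substitute X Y) (combine i m) v∈))))

  -- A run of Z := substitute X Y can only be prolonged within a single Y i, where it also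
  -- prolongs a run; l and lz are the signs last seen in the Y i and in Z.
  runs-substitute : ∀ {n} (X : SignVector p n) Y (l : Fin p → Maybe (Fin s)) lz →
    (∀ i m → lz ≡ just (combine i m) → l i ≡ just m) →
    (∀ i v m → lookup (Y i) v ≡ just m → lookup X v ≡ just i) →
    sum (λ i → runs (l i) (Y i)) ≤ runs lz (substitute X Y)
  runs-substitute []       Y l lz inv supp =
    ≤-reflexive (trans (∑ℕ.sum-cong-≗ (λ i → runs-[] (Y i))) (∑ℕ.sum-replicate-zero p))
    where
    runs-[] : ∀ {l} (V : SignVector s 0) → runs l V ≡ 0
    runs-[] [] = refl
  runs-substitute {suc n} (x ∷ X) Y l lz inv supp = step x refl
    where
    open ≤-Reasoning
    Y′ : Fin p → SignVector s n
    Y′ = tail ∘ Y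
    supp′ : ∀ i v m → lookup (Y′ i) v ≡ just m → lookup X v ≡ just i
    supp′ i v m eq = supp i (suc v) m (trans (sym (tail-lookup (Y i))) eq)
    runs-head-nothing : ∀ {l} (V : SignVector s (suc n)) → head V ≡ nothing →
      runs l V ≡ runs l (tail V)
    runs-head-nothing (nothing ∷ V) _ = refl
    runs-head-just : ∀ {l m} (V : SignVector s (suc n)) → head V ≡ just m →
      runs l V ≤ suc (runs (just m) (tail V))
    runs-head-just {l} {m} (just m ∷ V) refl = runs-∷-≤ l m V
    runs-head-same : ∀ {l m} (V : SignVector s (suc n)) → head V ≡ just m → l ≡ just m →
      runs l V ≡ runs (just m) (tail V)
    runs-head-same {m = m} (just m ∷ V) refl refl = runs-same m V
    silent : ∀ i → x ≢ just i → head (Y i) ≡ nothing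
    silent i x≢i with Y i | supp i zero
    ... | nothing ∷ _ | _ = refl
    ... | just m ∷ _  | s = contradiction (s m refl) x≢i
    quiet : (∀ i → head (Y i) ≡ nothing) →
      sum (λ i → runs (l i) (Y i)) ≤ runs lz (substitute X Y′)
    quiet none = begin
      sum (λ i → runs (l i) (Y i))  ≡⟨ ∑ℕ.sum-cong-≗ (λ i → runs-head-nothing (Y i) (none i)) ⟩
      sum (λ i → runs (l i) (Y′ i)) ≤⟨ runs-substitute X Y′ l lz inv supp′ ⟩
      runs lz (substitute X Y′)     ∎
    step : ∀ x′ → x ≡ x′ → sum (λ i → runs (l i) (Y i)) ≤
      runs lz (glue x′ (head ∘ Y) ∷ substitute X Y′)
    step nothing   refl = quiet (λ i → silent i λ ())
    step (just i₀) refl with head (Y i₀) in head≡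
    ... | nothing = quiet all-silent
      where
      all-silent : ∀ i → head (Y i) ≡ nothing
      all-silent i with i₀ FinP.≟ i
      ... | yes refl = head≡
      ... | no i₀≢i  = silent i (i₀≢i ∘ MaybeP.just-injective)
    ... | just m₀ = loud
      where
      l′ : Fin p → Maybe (Fin s)
      l′ = updateAt l i₀ (const (just m₀))
      l′-i₀ : l′ i₀ ≡ just m₀
      l′-i₀ = updateAt-updates i₀ l
      lz′ : Maybe (Fin (p * s))
      lz′ = just (combine i₀ m₀)
      inv′ : ∀ i m → lz′ ≡ just (combine i m) → l′ i ≡ just m
      inv′ i m eq with refl , refl ← FinP.combine-injective i₀ m₀ i m (MaybeP.just-injective eq) = l′-i₀
      IH : sum (λ i → runs (l′ i) (Y′ i)) ≤ runs lz′ (substitute X Y′)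
      IH = runs-substitute X Y′ l′ lz′ inv′ supp′
      others : ∀ i → i ≢ i₀ → runs (l i) (Y i) ≤ runs (l′ i) (Y′ i)
      others i i≢i₀ = ≤-reflexive (trans
        (runs-head-nothing (Y i) (silent i (i≢i₀ ∘ sym ∘ MaybeP.just-injective)))
        (cong (λ z → runs z (Y′ i)) (sym (updateAt-minimal i i₀ l i≢i₀))))
      loud : sum (λ i → runs (l i) (Y i)) ≤ runs lz (just (combine i₀ m₀) ∷ substitute X Y′)
      loud with lz ≟ₛ lz′
      -- `Z` opens no run here; by `inv` the last sign of `Y i₀` was `m₀` as well, so `Y i₀` opens
      -- none either.
      ... | yes refl = ≤-trans (sum-mono-≤ termwise) IH
        where
        termwise : ∀ i → runs (l i) (Y i) ≤ runs (l′ i) (Y′ i)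
        termwise i with i FinP.≟ i₀
        ... | yes refl  = ≤-reflexive (trans (runs-head-same (Y i) head≡ (inv i m₀ refl))
                            (cong (λ z → runs z (Y′ i)) (sym l′-i₀)))
        ... | no  i≢i₀ = others i i≢i₀
      -- `Z` gains a run, which pays for the only term that may gain one, that of `i₀`.
      ... | no _ = ≤-trans (sum-bump i₀ others at-i₀) (s≤s IH)
        where
        at-i₀ : runs (l i₀) (Y i₀) ≤ suc (runs (l′ i₀) (Y′ i₀))
        at-i₀ = subst (λ z → _ ≤ suc (runs z (Y′ i₀))) (sym l′-i₀) (runs-head-just (Y i₀) head≡)

nonzeros≤classes : ∀ {r n} (X : SignVector r n) → nonzeros X ≤ sum (λ i → ∣ class X i ∣)
nonzeros≤classes []            = z≤n
nonzeros≤classes (nothing ∷ X) = nonzeros≤classes X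
nonzeros≤classes (just a ∷ X)  = ≤-trans (s≤s (nonzeros≤classes X))
  (sum-mono-< (λ i → ∣∣-tail (⌊ just a ≟ₛ just i ⌋) (class X i)) a ∣∣-head)
  where
  ∣∣-tail : ∀ {n} b (S : Subset n) → ∣ S ∣ ≤ ∣ b ∷ S ∣
  ∣∣-tail true  S = n≤1+n _
  ∣∣-tail false S = ≤-refl
  ∣∣-head : ∣ class X a ∣ < ∣ class (just a ∷ X) a ∣
  ∣∣-head with just a ≟ₛ just a
  ... | yes _ = n<1+n _
  ... | no ≢  = contradiction refl ≢

expand : ∀ {A : Set} {n} → A → (S : Subset n) → Vec A ∣ S ∣ → Vec A n
expand z []          []      = []
expand z (true ∷ S)  (x ∷ X) = x ∷ expand z S X
expand z (false ∷ S) X       = z ∷ expand z S X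

expand-⊆ : ∀ {n} (S : Subset n) {T T′} → T ⊆ T′ → expand false S T ⊆ expand false S T′
expand-⊆ []          {[]}    {[]}     T⊆ = λ v∈ → v∈
expand-⊆ (true ∷ S)  {_ ∷ T} {_ ∷ T′} T⊆ {zero} here with here ← T⊆ here = here
expand-⊆ (true ∷ S)  {_ ∷ T} {_ ∷ T′} T⊆ {suc v} (there v∈) = there (expand-⊆ S (drop-∷-⊆ T⊆) v∈)
expand-⊆ (false ∷ S) T⊆ {suc v} (there v∈) = there (expand-⊆ S T⊆ v∈)

expand-⊆-base : ∀ {n} (S : Subset n) T → expand false S T ⊆ S
expand-⊆-base (true ∷ S)  (_ ∷ T) {zero}  _          = here
expand-⊆-base (true ∷ S)  (_ ∷ T) {suc v} (there v∈) = there (expand-⊆-base S T v∈)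
expand-⊆-base (false ∷ S) T       {suc v} (there v∈) = there (expand-⊆-base S T v∈)

class-expand : ∀ {r n} (S : Subset n) (X : SignVector r ∣ S ∣) i →
  class (expand nothing S X) i ≡ expand false S (class X i)
class-expand []          []      i = refl
class-expand (true ∷ S)  (x ∷ X) i = cong (⌊ x ≟ₛ just i ⌋ ∷_) (class-expand S X i)
class-expand (false ∷ S) X       i = cong (false ∷_) (class-expand S X i)

runs-expand : ∀ {r n} l (S : Subset n) (X : SignVector r ∣ S ∣) →
  runs l (expand nothing S X) ≡ runs l X
runs-expand l []          []            = refl
runs-expand l (true ∷ S)  (nothing ∷ X) = runs-expand l S X
runs-expand l (true ∷ S)  (just a ∷ X) with l ≟ₛ just a
... | yes _ = runs-expand l S X
... | no _  = cong suc (runs-expand (just a) S X)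
runs-expand l (false ∷ S) X             = runs-expand l S X

-- The dichotomy on `∣ A ∣` positions is carried into `A` by `expand`; the inserted zeros change no
-- run count and enter no class. The form with `∩ A` matches the families used in `dichotomy-*`.
dichotomy-within : ∀ {r} → Dichotomy r → ∀ {n k} (F : Fin k → Subset n → Set) →
  (∀ j S → Dec (F j S)) → (∀ j {S S′} → S ⊆ S′ → F j S → F j S′) → (A : Subset n) →
  (∃ λ j → ∃ λ (X : SignVector r n) → ∀ i → F j (class X i ∩ A)) ⊎
  (∃ λ (X : SignVector r n) → (∀ j i → ¬ F j (class X i)) × (∀ i → class X i ⊆ A) ×
    ∣ A ∣ ≤ runs nothing X + (r ∸ 1) * k)
dichotomy-within dichotomy F F? F-mono A
  with dichotomy (λ j S → F j (expand false A S)) (λ j S → F? j (expand false A S))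
    (λ j S⊆S′ → F-mono j (expand-⊆ A S⊆S′))
... | inj₁ (j , X , f) = inj₁ (j , expand nothing A X , λ i → F-mono j
  (λ v∈ → x∈p∩q⁺ (subst (_ ∈_) (sym (class-expand A X i)) v∈ , expand-⊆-base A (class X i) v∈))
  (f i))
... | inj₂ (X , ¬f , bound) = inj₂ (expand nothing A X ,
  (λ j i f → ¬f j i (subst (F j) (class-expand A X i) f)) ,
  (λ i v∈ → expand-⊆-base A (class X i) (subst (_ ∈_) (class-expand A X i) v∈)) ,
  subst (λ z → ∣ A ∣ ≤ z + _) (sym (runs-expand nothing A X)) bound)

dichotomy-* : ∀ p s → Dichotomy (suc p) → Dichotomy (suc s) → Dichotomy (suc p * suc s)
dichotomy-* p s dich-p dich-s {n} {k} F F? F-mono with dich-p G G? G-mono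
  where
  -- Disjoint members of `F j` inside `A` are encoded by the classes of one sign vector, which makes
  -- `G j` decidable by search.
  G : Fin k → Subset n → Set
  G j A = ∃ λ (Y : SignVector (suc s) n) → ∀ i → F j (class Y i ∩ A)
  G? : ∀ j A → Dec (G j A)
  G? j A = ∃-signVector? (λ Y → FinP.all? (λ i → F? j (class Y i ∩ A)))
  G-mono : ∀ j {A A′} → A ⊆ A′ → G j A → G j A′
  G-mono j {A} A⊆A′ (Y , f) = Y , λ i → F-mono j
    (λ v∈ → x∈p∩q⁺ (proj₁ (x∈p∩q⁻ (class Y i) A v∈) , A⊆A′ (proj₂ (x∈p∩q⁻ (class Y i) A v∈))))
    (f i)
... | inj₁ (j , X , g) = inj₁ (j , substitute X Y , λ c → F-at c)
  where
  Y : Fin (suc p) → SignVector (suc s) n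
  Y i = proj₁ (g i)
  F-at : ∀ c → F j (class (substitute X Y) c)
  F-at c with i , m , refl ← FinP.combine-surjective {suc p} {suc s} c =
    F-mono j (class-substitute-⊇ X Y i m) (proj₂ (g i) m)
... | inj₂ (X , ¬g , bound) = inj₂ (Z , ¬F-at , (begin
    n
      ≤⟨ bound ⟩
    runs nothing X + p * k
      -- The alternation of `X` is given up for the sizes of its classes; `runs-substitute` later
      -- rebuilds alternation from the `Y i`.
      ≤⟨ +-monoˡ-≤ (p * k) (≤-trans (runs≤nonzeros nothing X) (nonzeros≤classes X)) ⟩
    sum (λ i → ∣ class X i ∣) + p * k
      ≤⟨ +-monoˡ-≤ (p * k) (sum-mono-≤ (λ i → proj₂ (proj₂ (proj₂ (within i))))) ⟩
    sum (λ i → runs nothing (Y i) + s * k) + p * k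
      ≡⟨ cong (_+ p * k) (trans (∑ℕ.∑-distrib-+ (λ i → runs nothing (Y i)) (λ _ → s * k))
           (cong (sum (λ i → runs nothing (Y i)) +_) (sum-const (suc p) (s * k)))) ⟩
    sum (λ i → runs nothing (Y i)) + suc p * (s * k) + p * k
      ≤⟨ +-monoˡ-≤ (p * k) (+-monoˡ-≤ (suc p * (s * k))
           (runs-substitute X Y (λ _ → nothing) nothing (λ _ _ ()) supp)) ⟩
    runs nothing Z + suc p * (s * k) + p * k
      ≡⟨ regroup (runs nothing Z) p s k ⟩
    runs nothing Z + (suc p * suc s ∸ 1) * k ∎))
  where
  open ≤-Reasoning
  within : ∀ i → ∃ λ (Y : SignVector (suc s) n) → (∀ j m → ¬ F j (class Y m)) ×
    (∀ m → class Y m ⊆ class X i) × ∣ class X i ∣ ≤ runs nothing Y + s * k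
  within i with dichotomy-within dich-s F F? F-mono (class X i)
  ... | inj₁ (j , Y , f) = contradiction (Y , f) (¬g j i)
  ... | inj₂ found       = found
  Y : Fin (suc p) → SignVector (suc s) n
  Y i = proj₁ (within i)
  Z : SignVector (suc p * suc s) n
  Z = substitute X Y
  ¬F-at : ∀ j c → ¬ F j (class Z c)
  ¬F-at j c f with i , m , refl ← FinP.combine-surjective {suc p} {suc s} c =
    proj₁ (proj₂ (within i)) j m (F-mono j (class-substitute-⊆ X Y i m) f)
  supp : ∀ i v m → lookup (Y i) v ≡ just m → lookup X v ≡ just i
  supp i v m eq = ∈-class⁻ X i (proj₁ (proj₂ (proj₂ (within i))) m (∈-class⁺ (Y i) m eq))
  regroup : ∀ z p s k → z + suc p * (s * k) + p * k ≡ z + (s + p * suc s) * k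
  regroup = ℕSolver.solve-∀

-- Strong induction with the primes as base; a composite `r` splits into two smaller factors, each
-- at least 2.
dichotomy-≥2 : ∀ r → 2 ≤ r → Dichotomy r
dichotomy-≥2 = <-rec (λ r → 2 ≤ r → Dichotomy r) go
  where
  go : ∀ r → (∀ {r′} → r′ < r → 2 ≤ r′ → Dichotomy r′) → 2 ≤ r → Dichotomy r
  go 1        rec (s≤s ())
  go r@(2+ _) rec 2≤r with prime? r
  ... | yes r-prime = PrimeCase.dichotomy-prime _ r-prime
  ... | no ¬prime with ¬prime⇒composite ¬prime
  ... | hasNonTrivialDivisor {d} {{nt}} d<r (divides q eq) = factor q d (nonTrivial⇒n>1 d {{nt}}) d<r eq
    where
    factor : ∀ q d → 1 < d → d < r → r ≡ q * d → Dichotomy r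
    factor 0             d       _    _   ()
    factor 1             d       _    d<r eq = contradiction (trans (sym (*-identityˡ d)) (sym eq)) (<⇒≢ d<r)
    factor (2+ q) 1 (s≤s ()) _ _
    factor (2+ q) (2+ d) _ d<r eq = subst Dichotomy (sym eq)
      (dichotomy-* (suc q) (suc d) (rec q<r (s≤s (s≤s z≤n))) (rec d<r (s≤s (s≤s z≤n))))
      where
      q<r : 2+ q < r
      q<r = subst (2+ q <_) (sym eq) (m<m*n (2+ q) (2+ d) (s≤s z<s))

-- From sign vectors to alternation numbers and edge counts

altFrom-runs : ∀ {r n} l (f : Fin n → Maybe (Fin r)) →
  altFrom l (List.tabulate f) ≡ runs l (tabulate f)
altFrom-runs {n = zero}  l f = refl
altFrom-runs {n = suc n} l f with f zero
... | nothing = altFrom-runs l (f ∘ suc)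
... | just a with l ≟ₛ just a
... | yes _ = altFrom-runs l (f ∘ suc)
-- By `runs-shift` the branch that takes the entry attains the maximum.
... | no  _ = trans
  (cong₂ _⊔_ (altFrom-runs l (f ∘ suc)) (cong suc (altFrom-runs (just a) (f ∘ suc))))
  (m≤n⇒m⊔n≡n (runs-shift l (just a) (tabulate (f ∘ suc))))

alt-lookup : ∀ {r n} (X : SignVector r n) → alt (lookup X) ≡ runs nothing X
alt-lookup X = trans (altFrom-runs nothing (lookup X)) (cong (runs nothing) (VecP.tabulate∘lookup X))

image : ∀ {n} → Permutation′ n → Subset n → Subset n
image σ S = tabulate (λ v → lookup S (σ ⟨$⟩ˡ v))

∈-image⁻ : ∀ {n} (σ : Permutation′ n) S {v} → v ∈ image σ S → σ ⟨$⟩ˡ v ∈ S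
∈-image⁻ σ S {v} v∈ =
  VecP.lookup⇒[]= _ S (trans (sym (VecP.lookup∘tabulate _ v)) (VecP.[]=⇒lookup v∈))

∈-image⁺ : ∀ {n} (σ : Permutation′ n) S {v} → σ ⟨$⟩ˡ v ∈ S → v ∈ image σ S
∈-image⁺ σ S {v} v∈ =
  VecP.lookup⇒[]= v _ (trans (VecP.lookup∘tabulate _ v) (VecP.[]=⇒lookup v∈))

imageClass-lookup : ∀ {r n} (σ : Permutation′ n) (X : SignVector r n) i →
  imageClass σ (lookup X) i ≡ image σ (class X i)
imageClass-lookup σ X i = VecP.tabulate-cong (λ v → sym (VecP.lookup-map (σ ⟨$⟩ˡ v) _ X))

length-filter-tail : ∀ {A : Set} {Q : A → Set} (Q? : Decidable Q) x xs →
  length (filter Q? xs) ≤ length (filter Q? (x ∷ xs))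
length-filter-tail Q? x xs with Q? x
... | yes _ = n≤1+n _
... | no  _ = ≤-refl

-- Each element kept by `Q?` is counted again under its own colour.
length-filter-≤-sum : ∀ {A : Set} {Q : A → Set} {k} (Q? : Decidable Q) (c : A → Fin k) xs →
  length (filter Q? xs) ≤ sum (λ j → length (filter (λ x → (c x FinP.≟ j) ×-dec Q? x) xs))
length-filter-≤-sum Q? c []       = z≤n
length-filter-≤-sum Q? c (x ∷ xs) = step (Q? x)
  where
  Q?-at : ∀ j → Decidable (λ y → c y ≡ j × _)
  Q?-at j y = (c y FinP.≟ j) ×-dec Q? y
  IH : length (filter Q? xs) ≤ sum (λ j → length (filter (Q?-at j) xs))
  IH = length-filter-≤-sum Q? c xs
  step : Dec _ → length (filter Q? (x ∷ xs)) ≤ sum (λ j → length (filter (Q?-at j) (x ∷ xs)))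
  step (no ¬Qx) = ≤-trans (≤-reflexive (cong length (filter-reject Q? {x} {xs} ¬Qx)))
    (≤-trans IH (sum-mono-≤ (λ j → length-filter-tail (Q?-at j) x xs)))
  step (yes Qx) = ≤-trans (≤-reflexive (cong length (filter-accept Q? {x} {xs} Qx)))
    (≤-trans (s≤s IH) (sum-mono-< (λ j → length-filter-tail (Q?-at j) x xs) (c x)
      (≤-reflexive (sym (cong length (filter-accept (Q?-at (c x)) {x} {xs} (refl , Qx)))))))

lookup-injective : ∀ {A : Set} {xs : List A} → Unique xs → ∀ {i j} →
  List.lookup xs i ≡ List.lookup xs j → i ≡ j
lookup-injective (x∉ AllPairs.∷ u) {zero}  {zero}  eq = refl
lookup-injective (x∉ AllPairs.∷ u) {zero}  {suc j} eq =
  contradiction eq (All.lookup x∉ (∈-lookup j))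
lookup-injective (x∉ AllPairs.∷ u) {suc i} {zero}  eq =
  contradiction (sym eq) (All.lookup x∉ (∈-lookup i))
lookup-injective (x∉ AllPairs.∷ u) {suc i} {suc j} eq = cong suc (lookup-injective u eq)

-- Colourings and rich classes

module _ {n} (H : Hypergraph n) (σ : Permutation′ n) {k} (c : Coloring H k) where

  Inside? : (A : Subset n) → Decidable (λ e → edge H e ⊆ A)
  Inside? A e = edge H e ⊆? A

  Coloured? : ∀ j A → Decidable (λ e → c e ≡ j × edge H e ⊆ A)
  Coloured? j A e = (c e FinP.≟ j) ×-dec Inside? A e

  coloured : Fin k → Subset n → List (Fin (m H))
  coloured j A = filter (Coloured? j A) (allFin (m H))

  coloured-mono : ∀ j {A A′} → A ⊆ A′ → length (coloured j A) ≤ length (coloured j A′)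
  coloured-mono j {A} {A′} A⊆A′ = length-mono-≤
    (filter⁺ (Coloured? j A) (Coloured? j A′)
      (λ { refl (c≡ , e⊆) → c≡ , ⊆-trans e⊆ A⊆A′ }) (⊆-sublist-refl {x = allFin (m H)}))

  Rich : ℕ → Fin k → Subset n → Set
  Rich t j S = t ≤ length (coloured j (image σ S))

  Rich? : ∀ t j S → Dec (Rich t j S)
  Rich? t j S = t ≤? length (coloured j (image σ S))

  Rich-mono : ∀ t j {S S′} → S ⊆ S′ → Rich t j S → Rich t j S′
  Rich-mono t j {S} {S′} S⊆S′ rich =
    ≤-trans rich (coloured-mono j (λ v∈ → ∈-image⁺ σ S′ (S⊆S′ (∈-image⁻ σ S v∈))))

  -- The first `t` listed edges of colour `j` in each class form the parts. Edges from different
  -- classes are disjoint because a position has one sign, and then distinct because edges are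
  -- nonempty.
  rich⇒Krt : ∀ r t j (X : SignVector r n) → (∀ i → Rich t j (class X i)) → MonochromaticKrt H r t c
  rich⇒Krt r t j X rich = W , (injective , λ f i i′ i≢i′ → disjoint i (f i) i′ (f i′) i≢i′) ,
    λ i l i′ l′ → trans (colour i l) (sym (colour i′ l′))
    where
    E : Fin r → List (Fin (m H))
    E i = coloured j (image σ (class X i))
    W : Fin r → Fin t → Fin (m H)
    W i l = List.lookup (E i) (inject≤ l (rich i))
    W-spec : ∀ i l → c (W i l) ≡ j × edge H (W i l) ⊆ image σ (class X i)
    W-spec i l = proj₂ (∈-filter⁻ _ {xs = allFin (m H)} (∈-lookup {xs = E i} (inject≤ l (rich i))))
    colour : ∀ i l → c (W i l) ≡ j
    colour i l = proj₁ (W-spec i l)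
    sign : ∀ i l {v} → v ∈ edge H (W i l) → lookup X (σ ⟨$⟩ˡ v) ≡ just i
    sign i l v∈ = ∈-class⁻ X i (∈-image⁻ σ (class X i) (proj₂ (W-spec i l) v∈))
    disjoint : ∀ i l i′ l′ → ¬ (i ≡ i′) → Disjoint (edge H (W i l)) (edge H (W i′ l′))
    disjoint i l i′ l′ i≢i′ v v∈ v∈′ with refl ← trans (sym (sign i l v∈)) (sign i′ l′ v∈′) = i≢i′ refl
    injective : ∀ i l i′ l′ → W i l ≡ W i′ l′ → (i ≡ i′) × (l ≡ l′)
    injective i l i′ l′ eq with i FinP.≟ i′
    ... | no i≢i′ with v , v∈ ← nonemptyE H (W i l) =
      contradiction (subst (λ e → v ∈ edge H e) eq v∈) (disjoint i l i′ l′ i≢i′ v v∈)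
    ... | yes refl = refl , FinP.inject≤-injective (rich i) (rich i) l l′
      (lookup-injective (Uniqueₚ.filter⁺ _ (Uniqueₚ.allFin⁺ (m H))) eq)

  -- Each colour has at most `t - 1` edges in a class and there are at most `d - 1` colours. In the
  -- proof the matched `d` and `t` are these decremented numbers.
  poor⇒admissible : ∀ {d q r t} → k < d → 1 ≤ t → (d ∸ 1) * (t ∸ 1) + 1 ≤ q →
    (X : SignVector r n) → (∀ j i → ¬ Rich t j (class X i)) → Admissible r H σ q (lookup X)
  poor⇒admissible {suc d} {q} {r} {suc t} (s≤s k≤d) _ q≥ X poor i = begin
    inducedEdgeCount H (imageClass σ (lookup X) i)
      ≡⟨ cong (inducedEdgeCount H) (imageClass-lookup σ X i) ⟩
    inducedEdgeCount H A
      ≤⟨ length-filter-≤-sum (Inside? A) c (allFin (m H)) ⟩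
    sum (λ j → length (coloured j A))
      ≤⟨ sum-mono-≤ (λ j → s≤s⁻¹ (≰⇒> (poor j i))) ⟩
    sum {k} (λ _ → t)
      ≡⟨ sum-const k t ⟩
    k * t
      ≤⟨ *-monoˡ-≤ t k≤d ⟩
    d * t
      ≡⟨ m+n∸n≡m (d * t) 1 ⟨
    d * t + 1 ∸ 1
      ≤⟨ ∸-monoˡ-≤ 1 q≥ ⟩
    q ∸ 1 ∎
    where
    open ≤-Reasoning
    A : Subset n
    A = image σ (class X i)

-- The bound on the number of colours

⌈/⌉-≤ : ∀ x b k → x ≤ b * k → ⌈ x / b ⌉ ≤ k
⌈/⌉-≤ x zero    k x≤ = z≤n
-- Adding `b`, one less than the divisor, stays strictly below the next multiple `suc k * suc b`.
⌈/⌉-≤ x (suc b) k x≤ = s≤s⁻¹ (m<n*o⇒m/o<n (begin-strict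
  x + b            <⟨ +-mono-≤-< x≤ (n<1+n b) ⟩
  suc b * k + suc b ≡⟨ trans (+-comm _ (suc b)) (cong (suc b +_) (*-comm (suc b) k)) ⟩
  suc k * suc b    ∎))
  where open ≤-Reasoning

theorem4 : ∀ {n} (H : Hypergraph n) (σ : Permutation′ n) (d q r t : ℕ) →
    1 ≤ d → 1 ≤ q → 2 ≤ r → 1 ≤ t →
    (d ∸ 1) * (t ∸ 1) + 1 ≤ q →
    (a : ℕ) → IsAltR r H σ q a →
    (k : ℕ) (c : Coloring H k) → ¬ MonochromaticKrt H r t c →
    ⌈ (n ∸ a) / (r ∸ 1) ⌉ ⊓ d ≤ k
theorem4 {n} H σ d q r t _ _ 2≤r 1≤t q≥ a (_ , alt≤a) k c no-Krt with d ≤? k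
... | yes d≤k = m≤n⇒o⊓m≤n _ d≤k
... | no  d≰k
  with dichotomy-≥2 r 2≤r (Rich H σ c t) (Rich? H σ c t) (Rich-mono H σ c t)
... | inj₁ (j , X , rich) = contradiction (rich⇒Krt H σ c r t j X rich) no-Krt
-- Poverty in all `k < d` colours makes `X` admissible, so its alternation is at most `a`.
... | inj₂ (X , poor , n≤) = m≤n⇒m⊓o≤n d (⌈/⌉-≤ (n ∸ a) (r ∸ 1) k (m≤n+o⇒m∸n≤o n a (begin
  n                                 ≤⟨ n≤ ⟩
  runs nothing X + (r ∸ 1) * k      ≡⟨ cong (_+ (r ∸ 1) * k) (alt-lookup X) ⟨
  alt (lookup X) + (r ∸ 1) * k      ≤⟨ +-monoˡ-≤ ((r ∸ 1) * k)
    (alt≤a (lookup X) (poor⇒admissible H σ c (≰⇒> d≰k) 1≤t q≥ X poor)) ⟩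
  a + (r ∸ 1) * k                   ∎)))
  where open ≤-Reasoning
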